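{- $F_v(2,2,2,2;J_4)=15$. Moreover, up to isomorphism there are exactly $5$ graphs in $\mathcal{F}_v(2,2,2,2;J_4;15)$; exactly $1$ of them is maximal $J_4$-free, and exactly $2$ of them are minimal (with respect to the arrowing $(2,2,2,2)^v$).
   Context: All graphs are finite, simple and undirected. $J_k$ denotes the complete graph $K_k$ with one edge removed. A graph $G$ is $H$-free if it contains no subgraph (not necessarily induced) isomorphic to $H$. For integers $a_1,\dots,a_r\ge 1$, $G\rightarrow(a_1,\dots,a_r)^v$ means that for every coloring of the vertices of $G$ with colors $1,\dots,r$ there is some color $i$ and a clique on $a_i$ vertices all of color $i$. The vertex Folkman number is $F_v(a_1,\dots,a_r;H)=\min\{|V(G)| : G \text{ is } H\text{ -free and } G\rightarrow(a_1,\dots,a_r)^v\}$; $\mathcal{F}_v(a_1,\dots,a_r;H;n)$ is the set of $H$-free graphs on $n$ vertices with $G\rightarrow(a_1,\dots,a_r)^v$. A $J_4$-free graph is maximal $J_4$-free if adding any new edge creates a $J_4$. A graph $G$ with $G\rightarrow(a_1,\dots,a_r)^v$ is minimal if for every edge $e$, $G-e\not\rightarrow(a_1,\dots,a_r)^v$. Note $G\rightarrow(2,2,2,2)^v$ is equivalent to $\chi(G)\ge 5$. -}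

module Defs where

open import Data.Nat using (ℕ; _<_)
open import Data.Bool using (Bool; true; false)
open import Data.Fin using (Fin; zero; suc)
open import Data.Product using (Σ; _×_; _,_; ∃; ∃-syntax)
open import Data.Sum using (_⊎_)
open import Relation.Binary.PropositionalEquality using (_≡_; _≢_)
open import Relation.Nullary using (¬_)
open import Function.Definitions using (Injective)
open import Function.Bundles using (_↔_; Inverse)
open import Level using (0ℓ)

record Graph (n : ℕ) : Set where
  field
    adj    : Fin n → Fin n → Bool
    sym    : ∀ i j → adj i j ≡ adj j i
    irrefl : ∀ i → adj i i ≡ false
open Graph public

Edge : ∀ {n} → Graph n → Fin n → Fin n → Set
Edge G i j = adj G i j ≡ true

-- A (symmetric) adjacency relation on Fin n; used for G + e and G - e.
Rel : ℕ → Set₁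
Rel n = Fin n → Fin n → Set

Embeds : ∀ {k n} → Graph k → Rel n → Set
Embeds {k} {n} H E =
  Σ (Fin k → Fin n) λ f → Injective _≡_ _≡_ f × (∀ a b → Edge H a b → E (f a) (f b))

Contains : ∀ {k n} → Graph k → Graph n → Set
Contains H G = Embeds H (Edge G)

Free : ∀ {k n} → Graph k → Graph n → Set
Free H G = ¬ Contains H G

-- J₄ = K₄ minus the edge {0,1}.
J4adj : Fin 4 → Fin 4 → Bool
J4adj zero zero = false
J4adj zero (suc zero) = false
J4adj (suc zero) zero = false
J4adj (suc zero) (suc zero) = false
J4adj (suc (suc zero)) (suc (suc zero)) = false
J4adj (suc (suc (suc zero))) (suc (suc (suc zero))) = false
J4adj _ _ = true

J4 : Graph 4
J4 = record { adj = J4adj ; sym = s ; irrefl = ir }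
  where
  s : ∀ i j → J4adj i j ≡ J4adj j i
  s zero zero = _≡_.refl
  s zero (suc zero) = _≡_.refl
  s zero (suc (suc zero)) = _≡_.refl
  s zero (suc (suc (suc zero))) = _≡_.refl
  s (suc zero) zero = _≡_.refl
  s (suc zero) (suc zero) = _≡_.refl
  s (suc zero) (suc (suc zero)) = _≡_.refl
  s (suc zero) (suc (suc (suc zero))) = _≡_.refl
  s (suc (suc zero)) zero = _≡_.refl
  s (suc (suc zero)) (suc zero) = _≡_.refl
  s (suc (suc zero)) (suc (suc zero)) = _≡_.refl
  s (suc (suc zero)) (suc (suc (suc zero))) = _≡_.refl
  s (suc (suc (suc zero))) zero = _≡_.refl
  s (suc (suc (suc zero))) (suc zero) = _≡_.refl
  s (suc (suc (suc zero))) (suc (suc zero)) = _≡_.refl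
  s (suc (suc (suc zero))) (suc (suc (suc zero))) = _≡_.refl
  ir : ∀ i → J4adj i i ≡ false
  ir zero = _≡_.refl
  ir (suc zero) = _≡_.refl
  ir (suc (suc zero)) = _≡_.refl
  ir (suc (suc (suc zero))) = _≡_.refl

CliqueIn : ∀ {n} → Rel n → (Fin n → Set) → ℕ → Set
CliqueIn {n} E P a =
  Σ (Fin a → Fin n) λ f → Injective _≡_ _≡_ f
    × (∀ p q → p ≢ q → E (f p) (f q)) × (∀ p → P (f p))

ArrowsRel : ∀ {n r} → Rel n → (Fin r → ℕ) → Set
ArrowsRel {n} {r} E a =
  (c : Fin n → Fin r) → ∃[ i ] CliqueIn E (λ v → c v ≡ i) (a i)

Arrows : ∀ {n r} → Graph n → (Fin r → ℕ) → Set
Arrows G a = ArrowsRel (Edge G) a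

two4 : Fin 4 → ℕ
two4 _ = 2

InFamily : ∀ {k r} → (Fin r → ℕ) → Graph k → (n : ℕ) → Graph n → Set
InFamily a H n G = Free H G × Arrows G a

FolkmanNumberIs : ∀ {k r} → (Fin r → ℕ) → Graph k → ℕ → Set
FolkmanNumberIs a H m =
  (∃[ G ] InFamily a H m G) × (∀ n → n < m → (G : Graph n) → ¬ InFamily a H n G)

Iso : ∀ {n} → Graph n → Graph n → Set
Iso {n} G H =
  Σ (Fin n ↔ Fin n) λ φ → ∀ i j → adj G i j ≡ adj H (Inverse.to φ i) (Inverse.to φ j)

addEdge : ∀ {n} → Graph n → Fin n → Fin n → Rel n
addEdge G i j x y = Edge G x y ⊎ ((x ≡ i × y ≡ j) ⊎ (x ≡ j × y ≡ i))

removeEdge : ∀ {n} → Graph n → Fin n → Fin n → Rel n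
removeEdge G i j x y = Edge G x y × ¬ ((x ≡ i × y ≡ j) ⊎ (x ≡ j × y ≡ i))

MaximalFree : ∀ {k n} → Graph k → Graph n → Set
MaximalFree H G =
  Free H G × (∀ i j → i ≢ j → ¬ Edge G i j → Embeds H (addEdge G i j))

MinimalArrows : ∀ {n r} → Graph n → (Fin r → ℕ) → Set
MinimalArrows G a = Arrows G a × (∀ i j → Edge G i j → ¬ ArrowsRel (removeEdge G i j) a)

{-# OPTIONS --safe #-}
-- Let G be J₄-free on 15 vertices and not 4-colourable.
--
-- If G has an independent 5-set I, then H = G − I has 10 vertices and is not 3-colourable. Either H has no
-- independent 4-set, or it arises from 6 vertices by attaching an independent 4-set such that every 3-colouring
-- of the 6 vertices is blocked by a new vertex seeing all three colours; this leaves few H. For almost every H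
-- there is a 4-colouring such that no neighbourhood compatible with J₄-freeness meets all four classes, so that
-- I cannot be attached.
--
-- If G has no independent 5-set, let v have minimum degree. Its neighbours induce a matching and its
-- non-neighbours have no independent 4-set, so both parts come from small catalogues (there is no such second
-- part on 11 or more vertices, which bounds the degree below). The edges between the parts are searched for one
-- neighbour at a time: matched neighbours have disjoint neighbourhoods among the non-neighbours, unmatched ones
-- share no edge and miss no common independent triple, and a branch dies as soon as some colouring is proper
-- however the branch is completed.
--
-- All surviving graphs are isomorphic to one of five graphs without isolated vertices. A smaller example would
-- yield one with an isolated vertex on 15 vertices.
module Submission where

open import Defs
open import Data.Bool using (Bool; true; false; _∧_; _∨_; not; if_then_else_) renaming (_≟_ to _≟ᵇ_)
open import Data.Bool.ListAction using (all; any)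
open import Data.Bool.Properties using (T-≡; ∨-comm; ∧-comm; ∨-zeroʳ)
open import Data.Empty using (⊥; ⊥-elim)
open import Data.Fin using (Fin)
open import Data.Fin as Fin using (_≟_; toℕ; fromℕ<; cast)
open import Data.Fin.Patterns using (0F; 1F; 2F; 3F; 4F; 5F)
open import Data.Fin.Properties using (any?; all?; toℕ-fromℕ<; toℕ<n; toℕ-injective; toℕ-cast; cast-trans; cast-is-id)
open import Data.List using (List; []; _∷_; _++_; map; concatMap; foldr; length; null; replicate; upTo; zipWith; allFin; lookup)
import Data.List.Membership.DecPropositional as DecMembership
open import Data.List.Membership.Propositional using (_∈_; _∉_)
open import Data.List.Membership.Propositional.Properties using (∈-concatMap⁺; ∈-∃++; ∈-map⁺; ∈-++⁺ˡ; ∈-++⁺ʳ; ∈-++⁻; ∈-upTo⁻; ∈-allFin; ∈-lookup)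
open import Data.List.Properties using (length-tabulate; length-++; map-++; length-map; map-∘; map-cong; ++-identityʳ)
open import Data.List.Relation.Binary.Permutation.Propositional using (_↭_; ↭-refl; ↭-sym; ↭-trans; ↭-swap; prep; swap; ↭⇒↭ₛ)
open import Data.List.Relation.Binary.Permutation.Propositional.Properties using (∈-resp-↭; ↭-length; ↭-empty-inv; shift; ++⁺ʳ; ++⁺ˡ; ++⁺; map⁺)
import Data.List.Relation.Binary.Permutation.Setoid.Properties as PermutationSetoid
open import Data.List.Relation.Binary.Pointwise using (Pointwise; []; _∷_)
open import Data.List.Relation.Unary.All as All using (All; []; _∷_)
open import Data.List.Relation.Unary.AllPairs as AllPairs using (AllPairs; []; _∷_)
open import Data.List.Relation.Unary.Any as Any using (here; there)
open import Data.List.Relation.Unary.Any.Properties using (lookup-index)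
open import Data.List.Relation.Unary.Unique.Propositional using (Unique)
open import Data.List.Relation.Unary.Unique.Propositional.Properties using (allFin⁺) renaming (map⁺ to Unique-map⁺)
open import Data.Nat as ℕ using (ℕ; zero; suc; _+_; _*_; _∸_; _^_; _≡ᵇ_; _≤ᵇ_; _⊓_; _⊔_; _≤_; _<_; s≤s; z≤n)
open import Data.Nat.DivMod using (_/_; _%_)
open import Data.Nat.ListAction using (sum)
open import Data.Nat.ListAction.Properties using (sum-↭)
open import Data.Nat.Properties using (m^n≢0; +-suc; ≤-refl; ≤-trans; n<1+n; <⇒≤; m≤n⇒m≤1+n; <⇒≢; m⊓n≤m; <-≤-trans; suc-injective; ≤⇒≤ᵇ; ≤-reflexive; ≤-total; +-identityʳ; m+n∸m≡n; +-cancelˡ-≡; m≢1+m+n; m∸n+n≡m)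
open import Data.Product using (Σ; ∃; ∃₂; _×_; _,_; proj₁; proj₂; ∃-syntax)
open import Data.Sum using (_⊎_; inj₁; inj₂; [_,_]′)
open import Function using (_∘_; const)
open import Function.Bundles using (Equivalence; Inverse; _↔_; mk↔ₛ′)
open import Function.Properties.Inverse using (↔-sym)
open import Relation.Binary.PropositionalEquality using (_≡_; _≢_; refl; trans; cong; cong₂; subst; setoid) renaming (sym to ≡-sym)
open import Relation.Nullary using (Dec; ¬_; yes; no; does)
open import Relation.Nullary.Decidable using (map′; ¬?; _×-dec_; _→-dec_; _⊎-dec_; from-yes)
open import Relation.Unary using (Decidable)

-- Rows and triangular graphs

Row : Set
Row = List Bool

-- A triangular list of rows stores a graph: the first row lists the adjacencies of the newest vertex
-- to all older ones, newest first, and the remaining rows store the older vertices.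
Tri : Set
Tri = List Row

keep : {A : Set} → (A → Bool) → List A → List A
keep p [] = []
keep p (x ∷ xs) = if p x then x ∷ keep p xs else keep p xs

infixl 6 _∩_ _∪_

_∩_ _∪_ : Row → Row → Row
[] ∩ bs = []
(a ∷ as) ∩ [] = []
(a ∷ as) ∩ (b ∷ bs) = (a ∧ b) ∷ (as ∩ bs)
[] ∪ bs = []
(a ∷ as) ∪ [] = []
(a ∷ as) ∪ (b ∷ bs) = (a ∨ b) ∷ (as ∪ bs)

meets : Row → Row → Bool
meets (true ∷ as) (true ∷ bs) = true
meets (true ∷ as) (false ∷ bs) = meets as bs
meets (false ∷ as) (_ ∷ bs) = meets as bs
meets _ _ = false

meets₃ : Row → Row → Row → Bool
meets₃ (true ∷ as) (true ∷ bs) (c ∷ cs) = c ∨ meets₃ as bs cs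
meets₃ (true ∷ as) (false ∷ bs) (_ ∷ cs) = meets₃ as bs cs
meets₃ (false ∷ as) (_ ∷ bs) (_ ∷ cs) = meets₃ as bs cs
meets₃ _ _ _ = false

meetsTwice : Row → Row → Bool
meetsTwice (true ∷ as) (true ∷ bs) = meets as bs
meetsTwice (true ∷ as) (false ∷ bs) = meetsTwice as bs
meetsTwice (false ∷ as) (_ ∷ bs) = meetsTwice as bs
meetsTwice _ _ = false

-- Detects a `J₄` across two vertices with neighbourhoods `s` and `t`: an edge inside both
-- neighbourhoods is a hub with these two vertices as tips, whether or not they are adjacent.
edgeWithin : Tri → Row → Row → Bool
edgeWithin (r ∷ g) (true ∷ s) (true ∷ t) = meets₃ r s t ∨ edgeWithin g s t
edgeWithin (r ∷ g) (true ∷ s) (false ∷ t) = edgeWithin g s t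
edgeWithin (r ∷ g) (false ∷ s) (_ ∷ t) = edgeWithin g s t
edgeWithin _ _ _ = false

edgeBetween : Tri → Row → Row → Bool
edgeBetween (r ∷ g) (a ∷ s) (b ∷ t) = (a ∧ meets r t) ∨ ((b ∧ meets r s) ∨ edgeBetween g s t)
edgeBetween _ _ _ = false

-- Choosing a vertex adds its neighbours to the first forbidden row, so later choices are
-- independent of it; the second forbidden row stays fixed.
independentOutside : ℕ → Tri → Row → Row → Bool
independentOutside zero g s t = true
independentOutside (suc k) (r ∷ g) (false ∷ s) (false ∷ t) =
  independentOutside k g (s ∪ r) t ∨ independentOutside (suc k) g s t
independentOutside (suc k) (r ∷ g) (false ∷ s) (true ∷ t) = independentOutside (suc k) g s t
independentOutside (suc k) (r ∷ g) (true ∷ s) (_ ∷ t) = independentOutside (suc k) g s t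
independentOutside (suc k) _ _ _ = false

-- Candidate neighbourhoods of a new vertex `w`, decided one old vertex `x` at a time. A common edge
-- of `w` and `x` gives a `J₄`. If `w` and `x` are adjacent, so do two common neighbours, and so
-- does a triangle on `w`, `x` and a common neighbour that shares a second edge with another
-- triangle.
feasible : Tri → List Row
feasible [] = [] ∷ []
feasible (r ∷ g) = concatMap (λ s →
  if edgeWithin g s r then []
  else (false ∷ s) ∷ (if meetsTwice s r ∨ edgeBetween g (s ∩ r) (s ∪ r) then [] else ((true ∷ s) ∷ [])))
  (feasible g)

-- Correctness of the Boolean tests on rows

∧-true : ∀ {a b} → a ∧ b ≡ true → a ≡ true × b ≡ true
∧-true {true} {true} _ = refl , refl

∨-true : ∀ {a b} → a ∨ b ≡ true → a ≡ true ⊎ b ≡ true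
∨-true {true} _ = inj₁ refl
∨-true {false} e = inj₂ e

∨-false : ∀ {a b} → a ∨ b ≡ false → a ≡ false × b ≡ false
∨-false {false} {false} _ = refl , refl

refute : ∀ {b} → (b ≡ true → ⊥) → b ≡ false
refute {true} h = ⊥-elim (h refl)
refute {false} h = refl

true≢false : ∀ {b} → b ≡ true → b ≡ false → ⊥
true≢false refl ()

not-true : ∀ {b} → not b ≡ true → b ≡ false
not-true {false} _ = refl

module _ {A : Set} where

  ∈-keep : ∀ {p : A → Bool} {x xs} → x ∈ xs → p x ≡ true → x ∈ keep p xs
  ∈-keep {p} {xs = y ∷ _} (here refl) px rewrite px = here refl
  ∈-keep {p} {xs = y ∷ _} (there m) px with p y
  ... | true = there (∈-keep m px)
  ... | false = ∈-keep m px

  keep-∈ : ∀ (p : A → Bool) {x} xs → x ∈ keep p xs → x ∈ xs × p x ≡ true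
  keep-∈ p (y ∷ xs) m with p y in eq | m
  ... | true | here refl = here refl , eq
  ... | true | there m′ = let (a , b) = keep-∈ p xs m′ in there a , b
  ... | false | m′ = let (a , b) = keep-∈ p xs m′ in there a , b

  all-∈ : ∀ {p : A → Bool} {x xs} → all p xs ≡ true → x ∈ xs → p x ≡ true
  all-∈ e (here refl) = proj₁ (∧-true e)
  all-∈ e (there m) = all-∈ (proj₂ (∧-true e)) m

  all-false : ∀ (p : A → Bool) xs → all p xs ≡ false → ∃ λ x → x ∈ xs × p x ≡ false
  all-false p (x ∷ xs) e with p x in eq
  ... | false = x , here refl , eq
  ... | true = let (y , m , q) = all-false p xs e in y , there m , q

  any-∈ : ∀ (p : A → Bool) xs → any p xs ≡ true → ∃ λ x → x ∈ xs × p x ≡ true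
  any-∈ p (x ∷ xs) e with p x in eq
  ... | true = x , here refl , eq
  ... | false = let (y , m , q) = any-∈ p xs e in y , there m , q

  any-intro : ∀ {p : A → Bool} {x xs} → x ∈ xs → p x ≡ true → any p xs ≡ true
  any-intro (here refl) px rewrite px = refl
  any-intro {p} {xs = y ∷ _} (there m) px with p y
  ... | true = refl
  ... | false = any-intro m px

  ∩-map : ∀ (f h : A → Bool) xs → map f xs ∩ map h xs ≡ map (λ x → f x ∧ h x) xs
  ∩-map f h [] = refl
  ∩-map f h (x ∷ xs) = cong (_ ∷_) (∩-map f h xs)

  ∪-map : ∀ (f h : A → Bool) xs → map f xs ∪ map h xs ≡ map (λ x → f x ∨ h x) xs
  ∪-map f h [] = refl
  ∪-map f h (x ∷ xs) = cong (_ ∷_) (∪-map f h xs)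

  meets-sound : ∀ (f h : A → Bool) xs → meets (map f xs) (map h xs) ≡ true →
    ∃ λ x → x ∈ xs × f x ≡ true × h x ≡ true
  meets-sound f h (x ∷ xs) e with f x in p | h x in q
  ... | true | true = x , here refl , p , q
  ... | true | false = let (y , m , r) = meets-sound f h xs e in y , there m , r
  ... | false | _ = let (y , m , r) = meets-sound f h xs e in y , there m , r

  meets-complete : ∀ (f h : A → Bool) {x xs} → x ∈ xs → f x ≡ true → h x ≡ true →
    meets (map f xs) (map h xs) ≡ true
  meets-complete f h (here refl) p q rewrite p | q = refl
  meets-complete f h {xs = y ∷ _} (there m) p q with f y | h y
  ... | true | true = refl
  ... | true | false = meets-complete f h m p q
  ... | false | _ = meets-complete f h m p q

  meets₃-sound : ∀ (f h k : A → Bool) xs → meets₃ (map f xs) (map h xs) (map k xs) ≡ true →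
    ∃ λ x → f x ≡ true × h x ≡ true × k x ≡ true
  meets₃-sound f h k (x ∷ xs) e with f x in p | h x in q
  ... | false | _ = meets₃-sound f h k xs e
  ... | true | false = meets₃-sound f h k xs e
  ... | true | true with ∨-true {k x} e
  ...   | inj₁ r = x , p , q , r
  ...   | inj₂ e′ = meets₃-sound f h k xs e′

  meetsTwice-sound : ∀ (f h : A → Bool) xs → Unique xs → meetsTwice (map f xs) (map h xs) ≡ true →
    ∃₂ λ x y → x ∈ xs × y ∈ xs × x ≢ y × f x ≡ true × h x ≡ true × f y ≡ true × h y ≡ true
  meetsTwice-sound f h (x ∷ xs) (x∉ ∷ u) e with f x in p | h x in q
  ... | true | true = let (y , m , r , s) = meets-sound f h xs e in
    x , y , here refl , there m , All.lookup x∉ m , p , q , r , s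
  ... | true | false = let (x , y , m , m′ , r) = meetsTwice-sound f h xs u e in x , y , there m , there m′ , r
  ... | false | _ = let (x , y , m , m′ , r) = meetsTwice-sound f h xs u e in x , y , there m , there m′ , r

  meetsTwice-complete : ∀ (f h : A → Bool) {x y xs} → x ∈ xs → y ∈ xs → x ≢ y →
    f x ≡ true → h x ≡ true → f y ≡ true → h y ≡ true → meetsTwice (map f xs) (map h xs) ≡ true
  meetsTwice-complete f h (here refl) (here refl) x≢y _ _ _ _ = ⊥-elim (x≢y refl)
  meetsTwice-complete f h (here refl) (there m) _ p q r s rewrite p | q = meets-complete f h m r s
  meetsTwice-complete f h (there m) (here refl) _ p q r s rewrite r | s = meets-complete f h m p q
  meetsTwice-complete f h {xs = z ∷ _} (there m) (there m′) n p q r s with f z in e | h z in e′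
  ... | true | true = meets-complete f h m p q
  ... | true | false = meetsTwice-complete f h m m′ n p q r s
  ... | false | _ = meetsTwice-complete f h m m′ n p q r s

-- Permutations of lists and of triangular graphs

module _ {A : Set} where

  Unique-↭ : {xs ys : List A} → xs ↭ ys → Unique xs → Unique ys
  Unique-↭ p = PermutationSetoid.Unique-resp-↭ (setoid A) (↭⇒↭ₛ p)

  Unique-++ˡ : ∀ (xs : List A) {ys} → Unique (xs ++ ys) → Unique xs
  Unique-++ˡ [] u = []
  Unique-++ˡ (x ∷ xs) (x∉ ∷ u) = All.tabulate (λ m → All.lookup x∉ (∈-++⁺ˡ m)) ∷ Unique-++ˡ xs u

  Unique-++ʳ : ∀ (xs : List A) {ys} → Unique (xs ++ ys) → Unique ys
  Unique-++ʳ [] u = u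
  Unique-++ʳ (x ∷ xs) (_ ∷ u) = Unique-++ʳ xs u

  Unique-at : ∀ (xs : List A) {ys x} → x ∈ xs → Unique (xs ++ ys) → Unique (x ∷ ys)
  Unique-at (x ∷ xs) (here refl) (x∉ ∷ u) = All.tabulate (λ m → All.lookup x∉ (∈-++⁺ʳ xs m)) ∷ Unique-++ʳ xs u
  Unique-at (x ∷ xs) (there m) (_ ∷ u) = Unique-at xs m u

  ∈-↭ : ∀ {x : A} {xs} → x ∈ xs → ∃ λ ys → xs ↭ x ∷ ys
  ∈-↭ m with ys , zs , refl ← ∈-∃++ m = ys ++ zs , shift _ ys zs

  complement : ∀ (is xs : List A) → Unique is → (∀ {x} → x ∈ is → x ∈ xs) → ∃ λ ys → xs ↭ is ++ ys
  complement [] xs _ _ = xs , ↭-refl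
  complement (i ∷ is) xs (i∉ ∷ u) sub with ∈-↭ (sub (here refl))
  ... | xs′ , p with complement is xs′ u sub′
    where
    sub′ : ∀ {x} → x ∈ is → x ∈ xs′
    sub′ m with ∈-resp-↭ p (sub (there m))
    ... | here refl = ⊥-elim (All.lookup i∉ m refl)
    ... | there m′ = m′
  ...   | ys , q = ys , ↭-trans p (prep i q)

-- Permutations are coded by the successive positions of their entries
front : {A : Set} → ℕ → List A → List A
front zero xs = xs
front (suc k) [] = []
front (suc k) (x ∷ xs) with front k xs
... | [] = x ∷ []
... | y ∷ ys = y ∷ x ∷ ys

permute : {A : Set} → List ℕ → List A → List A
permute [] xs = xs
permute (k ∷ ks) xs with front k xs
... | [] = []
... | y ∷ ys = y ∷ permute ks ys

frontTri : ℕ → Tri → Tri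
frontTri zero g = g
frontTri (suc k) [] = []
frontTri (suc k) (r ∷ g) with front k r | frontTri k g
... | b ∷ r′ | s ∷ g′ = (b ∷ s) ∷ r′ ∷ g′
... | _ | _ = r ∷ []

permuteTri : List ℕ → Tri → Tri
permuteTri [] g = g
permuteTri (k ∷ ks) g with frontTri k g
... | [] = []
... | s ∷ g′ = permute ks s ∷ permuteTri ks g′

module _ {A : Set} where

  front-↭ : ∀ k (xs : List A) → front k xs ↭ xs
  front-↭ zero xs = ↭-refl
  front-↭ (suc k) [] = ↭-refl
  front-↭ (suc k) (x ∷ xs) with front k xs | front-↭ k xs
  ... | [] | p = prep x p
  ... | y ∷ ys | p = ↭-trans (↭-swap y x ↭-refl) (prep x p)

  permute-↭ : ∀ ks (xs : List A) → permute ks xs ↭ xs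
  permute-↭ [] xs = ↭-refl
  permute-↭ (k ∷ ks) xs with front k xs | front-↭ k xs
  ... | [] | p = p
  ... | y ∷ ys | p = ↭-trans (prep y (permute-↭ ks ys)) p

  front-map : ∀ {B : Set} (f : A → B) k xs → front k (map f xs) ≡ map f (front k xs)
  front-map f zero xs = refl
  front-map f (suc k) [] = refl
  front-map f (suc k) (x ∷ xs) rewrite front-map f k xs with front k xs
  ... | [] = refl
  ... | y ∷ ys = refl

  permute-map : ∀ {B : Set} (f : A → B) ks xs → permute ks (map f xs) ≡ map f (permute ks xs)
  permute-map f [] xs = refl
  permute-map f (k ∷ ks) xs rewrite front-map f k xs with front k xs
  ... | [] = refl
  ... | y ∷ ys = cong (f y ∷_) (permute-map f ks ys)

-- Triangular graphs induced by lists of vertices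

module InGraph {n : ℕ} (G : Graph n) where

  V : Set
  V = Fin n

  infix 7 _~_
  _~_ : V → V → Bool
  _~_ = adj G

  ~-sym : ∀ {x y b} → x ~ y ≡ b → y ~ x ≡ b
  ~-sym {x} {y} e = trans (Graph.sym G y x) e

  ~⇒≢ : ∀ {x y} → x ~ y ≡ true → x ≢ y
  ~⇒≢ {x} e refl = true≢false e (irrefl G x)

  row : V → List V → Row
  row w = map (w ~_)

  induced : List V → Tri
  induced [] = []
  induced (w ∷ ws) = row w ws ∷ induced ws

  length-induced : ∀ ws → length (induced ws) ≡ length ws
  length-induced [] = refl
  length-induced (w ∷ ws) = cong suc (length-induced ws)

  induced-front : ∀ k ws → induced (front k ws) ≡ frontTri k (induced ws)
  induced-front zero ws = refl
  induced-front (suc k) [] = refl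
  induced-front (suc k) (x ∷ ws)
    rewrite ≡-sym (induced-front k ws) | front-map (x ~_) k ws with front k ws | front-↭ k ws
  ... | [] | p with refl ← ↭-empty-inv (↭-sym p) = refl
  induced-front (suc k) (x ∷ ws) | y ∷ ys | p =
    cong (λ b → (b ∷ row y ys) ∷ row x ys ∷ induced ys) (~-sym refl)

  induced-permute : ∀ ks ws → induced (permute ks ws) ≡ permuteTri ks (induced ws)
  induced-permute [] ws = refl
  induced-permute (k ∷ ks) ws rewrite ≡-sym (induced-front k ws) with front k ws
  ... | [] = refl
  ... | y ∷ ys = cong₂ _∷_ (≡-sym (permute-map (y ~_) ks ys)) (induced-permute ks ys)

  edgeWithin-sound : ∀ f h ws → edgeWithin (induced ws) (map f ws) (map h ws) ≡ true →
    ∃₂ λ x y → x ~ y ≡ true × f x ≡ true × h x ≡ true × f y ≡ true × h y ≡ true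
  edgeWithin-sound f h (x ∷ ws) e with f x in p | h x in q
  ... | false | _ = edgeWithin-sound f h ws e
  ... | true | false = edgeWithin-sound f h ws e
  ... | true | true with ∨-true {meets₃ (row x ws) (map f ws) (map h ws)} e
  ...   | inj₁ e′ = let (y , a , b , c) = meets₃-sound (x ~_) f h ws e′ in x , y , a , p , q , b , c
  ...   | inj₂ e′ = edgeWithin-sound f h ws e′

  edgeBetween-sound : ∀ f h ws → edgeBetween (induced ws) (map f ws) (map h ws) ≡ true →
    ∃₂ λ x y → x ∈ ws × y ∈ ws × x ~ y ≡ true × f x ≡ true × h y ≡ true
  edgeBetween-sound f h (x ∷ ws) e with ∨-true {f x ∧ _} e
  ... | inj₁ e₁ = let (p , e₂) = ∧-true {f x} e₁ ; (y , m , a , b) = meets-sound (x ~_) h ws e₂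
                  in x , y , here refl , there m , a , p , b
  ... | inj₂ e₁ with ∨-true {h x ∧ _} e₁
  ...   | inj₁ e₂ = let (p , e₃) = ∧-true {h x} e₂ ; (y , m , a , b) = meets-sound (x ~_) f ws e₃
                    in y , x , there m , here refl , ~-sym a , b , p
  ...   | inj₂ e₂ = let (x′ , y , m , m′ , r) = edgeBetween-sound f h ws e₂ in x′ , y , there m , there m′ , r

  Apart : V → V → Set
  Apart x y = x ≢ y × x ~ y ≡ false

  Independent : List V → Set
  Independent = AllPairs Apart

  independent-unique : ∀ {is} → Independent is → Unique is
  independent-unique [] = []
  independent-unique (a ∷ as) = All.map proj₁ a ∷ independent-unique as

  independentOutside-sound : ∀ k f h ws → Unique ws →
    independentOutside k (induced ws) (map f ws) (map h ws) ≡ true →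
    ∃ λ is → length is ≡ k × Independent is × All (λ x → x ∈ ws × f x ≡ false × h x ≡ false) is
  independentOutside-sound zero f h ws _ _ = [] , refl , [] , []
  independentOutside-sound (suc k) f h (x ∷ ws) (x∉ ∷ u) e with f x in p | h x in q
  ... | true | _ = let (is , l , i , a) = independentOutside-sound (suc k) f h ws u e
                   in is , l , i , All.map (λ (m , r) → there m , r) a
  ... | false | true = let (is , l , i , a) = independentOutside-sound (suc k) f h ws u e
                       in is , l , i , All.map (λ (m , r) → there m , r) a
  ... | false | false with ∨-true {independentOutside k (induced ws) (map f ws ∪ row x ws) (map h ws)} e
  ...   | inj₂ e′ = let (is , l , i , a) = independentOutside-sound (suc k) f h ws u e′
                    in is , l , i , All.map (λ (m , r) → there m , r) a
  -- The enlarged forbidden row is again the row of a predicate, namely lying in `f` or being a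
  -- neighbour of `x`, so the induction hypothesis applies to it.
  ...   | inj₁ e′ rewrite ∪-map f (x ~_) ws =
    let (is , l , i , a) = independentOutside-sound k (λ y → f y ∨ x ~ y) h ws u e′
    in x ∷ is , cong suc l
       , All.map (λ { (m , r , _) → All.lookup x∉ m , proj₂ (∨-false r) }) a ∷ i
       , (here refl , p , q) ∷ All.map (λ { (m , r , s) → there m , proj₁ (∨-false r) , s }) a

-- Neighbourhoods allowed by J₄-freeness

-- The pointwise form of J₄-freeness: every edge lies in at most one triangle.
NoJ4 : ∀ {n} → Graph n → Set
NoJ4 G = ∀ {a b x y} → adj G a b ≡ true → adj G a x ≡ true → adj G a y ≡ true →
  adj G b x ≡ true → adj G b y ≡ true → x ≡ y

module InJ4FreeGraph {n : ℕ} (G : Graph n) (J : NoJ4 G) where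
  open InGraph G

  feasible-complete : ∀ w ws → Unique (w ∷ ws) → row w ws ∈ feasible (induced ws)
  feasible-complete w [] _ = here refl
  feasible-complete w (x ∷ ws) ((w≢x ∷ w∉) ∷ x∉ ∷ u) =
    ∈-concatMap⁺ _ (Any.map lemma (feasible-complete w ws (w∉ ∷ u)))
    where
    no-edge : edgeWithin (induced ws) (row w ws) (row x ws) ≡ false
    no-edge = refute λ e → let (a , b , ab , wa , xa , wb , xb) = edgeWithin-sound (w ~_) (x ~_) ws e
      in w≢x (J ab (~-sym wa) (~-sym xa) (~-sym wb) (~-sym xb))
    no-path : w ~ x ≡ true → meetsTwice (row w ws) (row x ws) ≡ true → ⊥
    no-path wx e = let (a , b , _ , _ , a≢b , wa , xa , wb , xb) = meetsTwice-sound (w ~_) (x ~_) ws u e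
      in a≢b (J wx wa wb xa xb)
    no-triangle : w ~ x ≡ true →
      edgeBetween (induced ws) (row w ws ∩ row x ws) (row w ws ∪ row x ws) ≡ true → ⊥
    no-triangle wx e rewrite ∩-map (w ~_) (x ~_) ws | ∪-map (w ~_) (x ~_) ws
      with a , z , _ , m , az , wxa , wxz ← edgeBetween-sound (λ y → w ~ y ∧ x ~ y) (λ y → w ~ y ∨ x ~ y) ws e
      with ∧-true {w ~ a} wxa | ∨-true {w ~ z} wxz
    -- The edge from `w` to `a` already lies in the triangle with `x`, so `z` would have to be `x`,
    -- which is not in `ws`. The other case exchanges `w` and `x`.
    ... | wa , xa | inj₁ wz = All.lookup x∉ m (J wa wx wz (~-sym xa) az)
    ... | wa , xa | inj₂ xz = All.lookup w∉ m (J xa (~-sym wx) xz (~-sym wa) az)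
    no-more : w ~ x ≡ true →
      meetsTwice (row w ws) (row x ws) ∨ edgeBetween (induced ws) (row w ws ∩ row x ws) (row w ws ∪ row x ws) ≡ false
    no-more wx = refute λ e → [ no-path wx , no-triangle wx ]′ (∨-true {meetsTwice (row w ws) (row x ws)} e)
    lemma : ∀ {s} → row w ws ≡ s → row w (x ∷ ws) ∈
      (if edgeWithin (induced ws) s (row x ws) then []
       else (false ∷ s) ∷ (if meetsTwice s (row x ws) ∨ edgeBetween (induced ws) (s ∩ row x ws) (s ∪ row x ws)
                           then [] else ((true ∷ s) ∷ [])))
    lemma refl rewrite no-edge with w ~ x in wx
    ... | false = here refl
    ... | true rewrite no-more wx = there (here refl)

-- Catalogues up to isomorphism

bits : ℕ → ℕ → Row
bits zero x = []
bits (suc k) x = (x % 2 ≡ᵇ 1) ∷ bits k (x / 2)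

-- The rows are packed into one binary number, the newest vertex in the lowest bits.
decode : ℕ → ℕ → Tri
decode zero x = []
decode (suc n) x = bits n x ∷ decode n ((x / 2 ^ n) {{m^n≢0 2 n}})

sameRow : Row → Row → Bool
sameRow [] [] = true
sameRow (true ∷ r) (true ∷ s) = sameRow r s
sameRow (false ∷ r) (false ∷ s) = sameRow r s
sameRow _ _ = false

sameTri : Tri → Tri → Bool
sameTri [] [] = true
sameTri (r ∷ g) (s ∷ h) = sameRow r s ∧ sameTri g h
sameTri _ _ = false

sameRow-sound : ∀ r s → sameRow r s ≡ true → r ≡ s
sameRow-sound [] [] _ = refl
sameRow-sound (true ∷ r) (true ∷ s) e = cong (true ∷_) (sameRow-sound r s e)
sameRow-sound (false ∷ r) (false ∷ s) e = cong (false ∷_) (sameRow-sound r s e)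

sameTri-sound : ∀ g h → sameTri g h ≡ true → g ≡ h
sameTri-sound [] [] _ = refl
sameTri-sound (r ∷ g) (s ∷ h) e =
  let (p , q) = ∧-true {sameRow r s} e in cong₂ _∷_ (sameRow-sound r s p) (sameTri-sound g h q)

weightAt : Row → List ℕ → ℕ
weightAt (true ∷ r) (w ∷ ws) = w + weightAt r ws
weightAt (false ∷ r) (w ∷ ws) = weightAt r ws
weightAt _ _ = 0

addAt : ℕ → Row → List ℕ → List ℕ
addAt w (true ∷ r) (x ∷ xs) = (w + x) ∷ addAt w r xs
addAt w (false ∷ r) (x ∷ xs) = x ∷ addAt w r xs
addAt w _ _ = []

neighbourWeights : List ℕ → Tri → List ℕ
neighbourWeights (w ∷ ws) (r ∷ g) = weightAt r ws ∷ addAt w r (neighbourWeights ws g)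
neighbourWeights _ _ = []

degrees : Tri → List ℕ
degrees g = neighbourWeights (map (const 1) g) g

-- One round of colour refinement; cubing makes the sum over the neighbours depend on more than the
-- total of their labels.
refineLabels : List ℕ → Tri → List ℕ
refineLabels ds g = zipWith (λ a b → a * 1000 + b) ds (neighbourWeights (map (_^ 3) ds) g)

labels : Tri → List ℕ
labels g = refineLabels (degrees g) g

-- A symmetric function of the labels, hence the same for isomorphic graphs. It filters the
-- comparisons in `lookFor`; the verdict itself comes from `isomorphic`.
key : Tri → ℕ
key g = foldr (λ x a → x * x * (x + 7) + a) 0 (labels g)

positions : ℕ → ℕ → List ℕ → List ℕ
positions i l [] = []
positions i l (x ∷ xs) = if l ≡ᵇ x then i ∷ positions (suc i) l xs else positions (suc i) l xs

-- The parity of the new label records adjacency to the vertex just matched, so vertices with equal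
-- labels agree on all matched vertices.
relabel : List ℕ → Row → List ℕ
relabel (l ∷ ls) (true ∷ r) = suc (2 * l) ∷ relabel ls r
relabel (l ∷ ls) (false ∷ r) = 2 * l ∷ relabel ls r
relabel _ _ = []

-- Only proposes permutations: isomorphic compares the permuted graph with its target, so nothing
-- has to be proved about labels and matchings.
matchings : List ℕ → Tri → List ℕ → Tri → List (List ℕ)
matchings lg g (l ∷ lh) (r ∷ h) = concatMap try (positions 0 l lg)
  where
  try : ℕ → List (List ℕ)
  try i with front i lg | frontTri i g
  ... | _ ∷ lg′ | s ∷ g′ = map (i ∷_) (matchings (relabel lg′ s) g′ (relabel lh r) h)
  ... | _ | _ = []
matchings lg g _ _ = [] ∷ []

isomorphic : Tri → Tri → Bool
isomorphic g h = any (λ ks → sameTri (permuteTri ks g) h) (matchings (labels g) g (labels h) h)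

keyed : List Tri → List (ℕ × Tri)
keyed = map (λ h → key h , h)

lookFor : ℕ → Tri → List (ℕ × Tri) → Bool
lookFor k g [] = false
lookFor k g ((l , h) ∷ hs) = ((k ≡ᵇ l) ∧ isomorphic g h) ∨ lookFor k g hs

known : List (ℕ × Tri) → Tri → Bool
known hs g = lookFor (key g) g hs

_≅∈_ : Tri → List Tri → Set
g ≅∈ hs = ∃ λ ks → permuteTri ks g ∈ hs

lookFor-sound : ∀ k g hs → lookFor k g (keyed hs) ≡ true → g ≅∈ hs
lookFor-sound k g (h ∷ hs) e with ∨-true {(k ≡ᵇ key h) ∧ isomorphic g h} e
... | inj₁ e′ = let (ks , _ , q) = any-∈ _ (matchings (labels g) g (labels h) h) (proj₂ (∧-true {k ≡ᵇ key h} e′))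
                in ks , here (sameTri-sound _ h q)
... | inj₂ e′ = let (ks , m) = lookFor-sound k g hs e′ in ks , there m

-- The induction step of a classification: every one-vertex extension of a listed graph by a
-- candidate row is again listed up to isomorphism.
covers : List (ℕ × Tri) → (Tri → List Row) → List Tri → Bool
covers hs cand = all (λ g → all (λ s → known hs (s ∷ g)) (cand g))

covers-sound : ∀ cand {hs gs g s} → covers (keyed hs) cand gs ≡ true →
  g ∈ gs → s ∈ cand g → (s ∷ g) ≅∈ hs
covers-sound cand {hs} {g = g} e m c = lookFor-sound _ _ hs (all-∈ (all-∈ e m) c)

-- An independent triple outside the neighbourhood of the new vertex would complete an independent
-- 4-set with it.
sparse : Tri → List Row
sparse g = keep (λ s → not (independentOutside 3 g s s)) (feasible g)

-- Extensions inside the neighbourhood of a fixed vertex: the new vertex has at most one neighbour,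
-- that neighbour was isolated before, and no independent 4-set avoids the new neighbourhood. The
-- graphs are therefore matchings without independent 5-set.
matched : Tri → List Row
matched g = keep (λ s → not (meetsTwice s s ∨ (edgeBetween g s (map (const true) s) ∨ independentOutside 4 g s s))) (feasible g)

record Catalogue (cand : Tri → List Row) : Set where
  field
    at : ℕ → List Tri
    start : [] ∈ at 0
    closed : ∀ n → covers (keyed (at (suc n))) cand (at n) ≡ true

module CatalogueIn {n : ℕ} (G : Graph n) where
  open InGraph G

  ≅∈-permutation : ∀ ws {hs} → induced ws ≅∈ hs → ∃ λ ws′ → ws′ ↭ ws × induced ws′ ∈ hs
  ≅∈-permutation ws (ks , m) = permute ks ws , permute-↭ ks ws , subst (_∈ _) (≡-sym (induced-permute ks ws)) m

  -- Induction on the list: the tail is first reordered into a catalogued graph, the head is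
  -- attached to this reordering, and closure supplies a reordering of the whole. `Escape` is the
  -- alternative outcome, such as a large independent set.
  find : ∀ cand (L : Catalogue cand) (P Escape : List V → Set) →
    (∀ {w ws} → P (w ∷ ws) → P ws) → (∀ {w ws} → Escape ws → Escape (w ∷ ws)) →
    (∀ {w ws ws′} → P (w ∷ ws) → ws′ ↭ ws → Escape (w ∷ ws) ⊎ row w ws′ ∈ cand (induced ws′)) →
    ∀ ws → P ws → Escape ws ⊎ (∃ λ ws′ → ws′ ↭ ws × induced ws′ ∈ Catalogue.at L (length ws))
  find cand L P Escape tail weaken step [] p = inj₂ ([] , ↭-refl , Catalogue.start L)
  find cand L P Escape tail weaken step (w ∷ ws) p with find cand L P Escape tail weaken step ws (tail p)
  ... | inj₁ x = inj₁ (weaken x)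
  ... | inj₂ (ws′ , π , m) with step p π
  ...   | inj₁ x = inj₁ x
  ...   | inj₂ c =
    let (ws″ , π′ , m′) = ≅∈-permutation (w ∷ ws′) (covers-sound cand (Catalogue.closed L _) m c)
    in inj₂ (ws″ , ↭-trans π′ (prep w π) , m′)

  IndependentIn : ℕ → List V → Set
  IndependentIn k ws = ∃ λ is → length is ≡ k × Independent is × All (_∈ ws) is

  weakenIn : ∀ {k w ws} → IndependentIn k ws → IndependentIn k (w ∷ ws)
  weakenIn (is , l , i , m) = is , l , i , All.map there m

  outside-neighbourhood : ∀ k w ws → Unique (w ∷ ws) →
    independentOutside k (induced ws) (row w ws) (row w ws) ≡ true → IndependentIn (suc k) (w ∷ ws)
  outside-neighbourhood k w ws (w∉ ∷ u) e =
    let (is , l , i , a) = independentOutside-sound k (w ~_) (w ~_) ws u e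
    in w ∷ is , cong suc l , All.map (λ (m , p , _) → All.lookup w∉ m , p) a ∷ i
       , here refl ∷ All.map (λ (m , _) → there m) a

  IndependentIn-↭ : ∀ {k ws ws′} → ws ↭ ws′ → IndependentIn k ws → IndependentIn k ws′
  IndependentIn-↭ π (is , l , i , m) = is , l , i , All.map (∈-resp-↭ π) m

  module _ (J : NoJ4 G) where
    open InJ4FreeGraph G J

    Unique-tail : ∀ {w : V} {ws} → Unique (w ∷ ws) → Unique ws
    Unique-tail (_ ∷ u) = u

    find-sparse : (L : Catalogue sparse) → ∀ ws → Unique ws →
      IndependentIn 4 ws ⊎ (∃ λ ws′ → ws′ ↭ ws × induced ws′ ∈ Catalogue.at L (length ws))
    find-sparse L = find sparse L Unique (IndependentIn 4) Unique-tail weakenIn step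
      where
      step : ∀ {w ws ws′} → Unique (w ∷ ws) → ws′ ↭ ws →
        IndependentIn 4 (w ∷ ws) ⊎ row w ws′ ∈ sparse (induced ws′)
      step {w} {ws} {ws′} u π with Unique-↭ (prep w (↭-sym π)) u
      ... | u′ with independentOutside 3 (induced ws′) (row w ws′) (row w ws′) in e
      ...   | true = inj₁ (IndependentIn-↭ (prep w π) (outside-neighbourhood 3 w ws′ u′ e))
      ...   | false = inj₂ (∈-keep (feasible-complete w ws′ u′) (cong not e))

    module _ (v : V) where

      find-matched : (L : Catalogue matched) → ∀ ws → Unique ws × All (λ w → v ~ w ≡ true) ws →
        IndependentIn 5 ws ⊎ (∃ λ ws′ → ws′ ↭ ws × induced ws′ ∈ Catalogue.at L (length ws))
      find-matched L = find matched L (λ ws → Unique ws × All (λ w → v ~ w ≡ true) ws) (IndependentIn 5)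
          (λ { (_ ∷ u , _ ∷ a) → u , a }) weakenIn step
        where
        step : ∀ {w ws ws′} → Unique (w ∷ ws) × All (λ w → v ~ w ≡ true) (w ∷ ws) → ws′ ↭ ws →
          IndependentIn 5 (w ∷ ws) ⊎ row w ws′ ∈ matched (induced ws′)
        step {w} {ws} {ws′} (u , vw ∷ vs) π with Unique-↭ (prep w (↭-sym π)) u
        ... | u′@(w∉ ∷ u″) with independentOutside 4 (induced ws′) (row w ws′) (row w ws′) in e
        ...   | true = inj₁ (IndependentIn-↭ (prep w π) (outside-neighbourhood 4 w ws′ u′ e))
        ...   | false = inj₂ (∈-keep (feasible-complete w ws′ u′) (cong not test))
          where
          adjacent : ∀ {x} → x ∈ ws′ → v ~ x ≡ true
          adjacent m = All.lookup vs (∈-resp-↭ π m)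
          -- Two neighbours of `w` in the neighbourhood of `v` would put the edge from `v` to `w`
          -- into two triangles.
          one : meetsTwice (row w ws′) (row w ws′) ≡ false
          one = refute λ e → let (x , y , m , m′ , x≢y , wx , _ , wy , _) = meetsTwice-sound (w ~_) (w ~_) ws′ u″ e
            in x≢y (J vw (adjacent m) (adjacent m′) wx wy)
          -- If a neighbour `x` of `w` had a further neighbour `y`, the edge from `v` to `x` would
          -- lie in triangles with `w` and with `y`.
          isolated : edgeBetween (induced ws′) (row w ws′) (map (const true) (row w ws′)) ≡ false
          isolated rewrite ≡-sym (map-∘ {g = const true} {f = w ~_} ws′) = refute λ e →
            let (x , y , m , m′ , xy , wx , _) = edgeBetween-sound (w ~_) (const true) ws′ e
            in All.lookup w∉ m′ (J (adjacent m) vw (adjacent m′) (~-sym wx) xy)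
          test : meetsTwice (row w ws′) (row w ws′) ∨
            (edgeBetween (induced ws′) (row w ws′) (map (const true) (row w ws′)) ∨
             independentOutside 4 (induced ws′) (row w ws′) (row w ws′)) ≡ false
          test rewrite one | isolated = e

-- Colourings and attached independent sets

clash : ℕ → Row → List ℕ → Bool
clash c (true ∷ r) (x ∷ xs) = if c ≡ᵇ x then true else clash c r xs
clash c (false ∷ r) (x ∷ xs) = clash c r xs
clash c _ _ = false

extend : List ℕ → Row → List ℕ → List (List ℕ) → List (List ℕ)
extend [] r cs rest = rest
extend (c ∷ p) r cs rest = if clash c r cs then extend p r cs rest else (c ∷ cs) ∷ extend p r cs rest

extendAll : (List ℕ → List ℕ) → Row → List (List ℕ) → List (List ℕ)
extendAll palette r = foldr (λ cs → extend (palette cs) r cs) []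

-- Colours are introduced in increasing order, so colourings are listed once up to renaming colours
orderedPalette : ℕ → List ℕ → List ℕ
orderedPalette q cs = upTo (q ⊓ suc (foldr (λ c m → suc c ⊔ m) 0 cs))

colourings : ℕ → Tri → List (List ℕ)
colourings q [] = [] ∷ []
colourings q (r ∷ g) = extendAll (orderedPalette q) r (colourings q g)

-- A vertex with this neighbourhood blocks the colouring: no colour is left for it.
rainbow : ℕ → Row → List ℕ → Bool
rainbow q s cs = all (λ c → clash c s cs) (upTo q)

-- Branching on the first colouring not yet blocked: some vertex still to be attached must block it.
-- Once all are blocked, every candidate row is tried.
rainbowRows : ℕ → List Row → List (List ℕ) → List Row
rainbowRows q ss [] = ss
rainbowRows q ss (cs ∷ _) = keep (λ s → rainbow q s cs) ss

-- Here `k` vertices are still to come and `j` are attached, `ss` holds the rows that remain allowed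
-- and `un` the colourings not yet blocked. The leading `j` entries false of a new row express
-- independence from the attached vertices.
attach : ℕ → Tri → ℕ → ℕ → List Row → List (List ℕ) → Tri → List Tri
attach q base zero j ss [] g = g ∷ []
attach q base zero j ss (_ ∷ _) g = []
attach q base (suc k) j ss un g = concatMap (λ s →
    attach q base k (suc j) (keep (λ t → not (edgeWithin base s t)) ss)
      (keep (λ cs → not (rainbow q s cs)) un) ((replicate j false ++ s) ∷ g))
  (rainbowRows q ss un)

-- A colouring of the base that no candidate row blocks extends to any attached independent set, so
-- the base is discarded at once.
completionsFrom : ℕ → ℕ → Tri → List Row → List (List ℕ) → List Tri
completionsFrom q k base ss un =
  if any (λ cs → not (any (λ s → rainbow q s cs) ss)) un then [] else attach q base k 0 ss un base

completions : ℕ → ℕ → Tri → List Tri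
completions q k base = completionsFrom q k base (feasible base) (colourings q base)

≡ᵇ-refl : ∀ c → (c ≡ᵇ c) ≡ true
≡ᵇ-refl zero = refl
≡ᵇ-refl (suc c) = ≡ᵇ-refl c

extend-∈ : ∀ p r cs {rest ds} → ds ∈ extend p r cs rest →
  (∃ λ c → c ∈ p × clash c r cs ≡ false × ds ≡ c ∷ cs) ⊎ ds ∈ rest
extend-∈ [] r cs m = inj₂ m
extend-∈ (c ∷ p) r cs m with clash c r cs in e
extend-∈ (c ∷ p) r cs (here refl) | false = inj₁ (c , here refl , e , refl)
extend-∈ (c ∷ p) r cs (there m) | false with extend-∈ p r cs m
... | inj₁ (d , m′ , x) = inj₁ (d , there m′ , x)
... | inj₂ m′ = inj₂ m′
extend-∈ (c ∷ p) r cs m | true with extend-∈ p r cs m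
... | inj₁ (d , m′ , x) = inj₁ (d , there m′ , x)
... | inj₂ m′ = inj₂ m′

extendAll-∈ : ∀ palette r css {ds} → ds ∈ extendAll palette r css →
  ∃₂ λ c cs → cs ∈ css × c ∈ palette cs × clash c r cs ≡ false × ds ≡ c ∷ cs
extendAll-∈ palette r (cs ∷ css) m with extend-∈ (palette cs) r cs m
... | inj₁ (c , x) = c , cs , here refl , x
... | inj₂ m′ = let (c , cs , m″ , x) = extendAll-∈ palette r css m′ in c , cs , there m″ , x

-- Colourings of lists of vertices and soundness of the attachment

module Colouring {n : ℕ} (G : Graph n) where
  open InGraph G

  infixr 5 _∷⟨_⟩_
  data Coloured (q : ℕ) : List V → List ℕ → Set where
    [] : Coloured q [] []
    _∷⟨_⟩_ : ∀ {w ws c cs} → c < q → clash c (row w ws) cs ≡ false → Coloured q ws cs → Coloured q (w ∷ ws) (c ∷ cs)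

  colourOf : List V → List ℕ → V → ℕ
  colourOf (w ∷ ws) (c ∷ cs) x with x ≟ w
  ... | yes _ = c
  ... | no _ = colourOf ws cs x
  colourOf _ _ x = 0

  Proper : ℕ → List V → (V → ℕ) → Set
  Proper q xs f = (∀ {x} → x ∈ xs → f x < q) × (∀ {x y} → x ∈ xs → y ∈ xs → x ~ y ≡ true → f x ≢ f y)

  NotColourable : ℕ → List V → Set
  NotColourable q xs = ∀ f → ¬ Proper q xs f

  NotColourable-↭ : ∀ {q xs ys} → xs ↭ ys → NotColourable q xs → NotColourable q ys
  NotColourable-↭ π h f (b , p) =
    h f ((λ m → b (∈-resp-↭ π m)) , λ m m′ → p (∈-resp-↭ π m) (∈-resp-↭ π m′))

  clash-complete : ∀ {q} f {ws cs y} → Coloured q ws cs → y ∈ ws → f y ≡ true →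
    clash (colourOf ws cs y) (map f ws) cs ≡ true
  clash-complete f {w ∷ ws} {c ∷ cs} {y} (_ ∷⟨ _ ⟩ C) m e with y ≟ w
  ... | yes refl rewrite e | ≡ᵇ-refl c = refl
  clash-complete f (_ ∷⟨ _ ⟩ C) (here refl) e | no y≢w = ⊥-elim (y≢w refl)
  clash-complete f {w ∷ ws} {c ∷ cs} {y} (_ ∷⟨ _ ⟩ C) (there m) e | no _ with f w
  ... | false = clash-complete f C m e
  ... | true with colourOf ws cs y ≡ᵇ c
  ...   | true = refl
  ...   | false = clash-complete f C m e

  coloured-bound : ∀ {q ws cs x} → Coloured q ws cs → x ∈ ws → colourOf ws cs x < q
  coloured-bound {ws = w ∷ ws} {x = x} (b ∷⟨ _ ⟩ C) m with x ≟ w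
  ... | yes _ = b
  coloured-bound (_ ∷⟨ _ ⟩ C) (here refl) | no x≢w = ⊥-elim (x≢w refl)
  coloured-bound (_ ∷⟨ _ ⟩ C) (there m) | no _ = coloured-bound C m

  coloured-distinct : ∀ {q ws cs x y} → Coloured q ws cs → x ∈ ws → y ∈ ws → x ~ y ≡ true →
    colourOf ws cs x ≢ colourOf ws cs y
  coloured-distinct {ws = w ∷ ws} {x = x} {y} (_ ∷⟨ e ⟩ C) m m′ a eq with x ≟ w | y ≟ w
  ... | yes refl | yes refl = ~⇒≢ a refl
  coloured-distinct (_ ∷⟨ e ⟩ C) m (here refl) a eq | yes refl | no y≢w = y≢w refl
  coloured-distinct {x = x} (_ ∷⟨ e ⟩ C) m (there m′) a refl | yes refl | no _ =
    true≢false (clash-complete (x ~_) C m′ a) e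
  coloured-distinct (_ ∷⟨ e ⟩ C) (here refl) m′ a eq | no x≢w | _ = x≢w refl
  coloured-distinct {y = y} (_ ∷⟨ e ⟩ C) (there m) m′ a refl | no _ | yes refl =
    true≢false (clash-complete (y ~_) C m (~-sym a)) e
  coloured-distinct (_ ∷⟨ e ⟩ C) (there m) (here refl) a eq | no _ | no y≢w = y≢w refl
  coloured-distinct (_ ∷⟨ e ⟩ C) (there m) (there m′) a eq | no _ | no _ = coloured-distinct C m m′ a eq

  coloured-proper : ∀ {q ws cs} → Coloured q ws cs → Proper q ws (colourOf ws cs)
  coloured-proper C = coloured-bound C , coloured-distinct C

  colourings-sound : ∀ q ws {cs} → cs ∈ colourings q (induced ws) → Coloured q ws cs
  colourings-sound q [] (here refl) = []
  colourings-sound q (w ∷ ws) m with extendAll-∈ (orderedPalette q) (row w ws) (colourings q (induced ws)) m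
  ... | c , cs , m′ , p , e , refl = <-≤-trans (∈-upTo⁻ p) (m⊓n≤m q _) ∷⟨ e ⟩ colourings-sound q ws m′

  Apart-sym : ∀ {x y} → Apart x y → Apart y x
  Apart-sym (n , e) = (λ x → n (≡-sym x)) , ~-sym e

  Independent-↭ : ∀ {xs ys} → xs ↭ ys → Independent xs → Independent ys
  Independent-↭ π = PermutationSetoid.AllPairs-resp-↭ (setoid V) Apart-sym ((λ { refl x → x }) , (λ { refl x → x })) (↭⇒↭ₛ π)

  clash-independent : ∀ c i is {ds} bs {cs} → All (Apart i) is → length ds ≡ length is →
    clash c (row i (is ++ bs)) (ds ++ cs) ≡ clash c (row i bs) cs
  clash-independent c i [] {[]} bs _ _ = refl
  clash-independent c i (x ∷ is) {d ∷ ds} bs ((_ , e) ∷ a) l rewrite e =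
    clash-independent c i is bs a (suc-injective l)

  -- Each vertex of the independent set misses some colour on the base, and these colours can be
  -- chosen separately because the set spans no edge.
  colour-independent : ∀ {q bs cs} is → Independent is → Coloured q bs cs →
    All (λ i → rainbow q (row i bs) cs ≡ false) is →
    ∃ λ ds → length ds ≡ length is × Coloured q (is ++ bs) (ds ++ cs)
  colour-independent [] _ C _ = [] , refl , C
  colour-independent {q} {bs} {cs} (i ∷ is) (a ∷ ind) C (e ∷ es) with colour-independent is ind C es
  ... | ds , l , D with all-false (λ c → clash c (row i bs) cs) (upTo q) e
  ...   | c , m , e′ = c ∷ ds , cong suc l
    , ∈-upTo⁻ m ∷⟨ trans (clash-independent c i is bs a l) e′ ⟩ D

  rainbow-exists : ∀ {q is bs cs} → Independent is → NotColourable q (is ++ bs) → Coloured q bs cs →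
    ∃ λ i → i ∈ is × rainbow q (row i bs) cs ≡ true
  rainbow-exists {q} {is} {bs} {cs} I N C with any (λ i → rainbow q (row i bs) cs) is in e
  ... | true = any-∈ _ is e
  ... | false = ⊥-elim (N _ (coloured-proper (proj₂ (proj₂ (colour-independent is I C
      (All.tabulate λ m → refute λ t → true≢false (any-intro m t) e))))))

  row-apart : ∀ r ch bs → All (Apart r) ch → row r (ch ++ bs) ≡ replicate (length ch) false ++ row r bs
  row-apart r [] bs _ = refl
  row-apart r (x ∷ ch) bs ((_ , e) ∷ a) = cong₂ _∷_ e (row-apart r ch bs a)

  module Attach (J : NoJ4 G) (q : ℕ) (bs : List V) where
    open InJ4FreeGraph G J

    base : Tri
    base = induced bs

    -- The invariant of `attach`: `ch` are the vertices attached so far and `rem` those of the given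
    -- independent set still to be attached; `unhit` says that no vertex of `ch` blocks a colouring
    -- in `un`.
    record State (ch rem : List V) (ss : List Row) (un : List (List ℕ)) : Set where
      field
        independent : Independent (rem ++ ch)
        uncolourable : NotColourable q ((rem ++ ch) ++ bs)
        candidates : All (λ r → row r bs ∈ ss) rem
        unhit : All (λ cs → Coloured q bs cs × All (λ i → rainbow q (row i bs) cs ≡ false) ch) un

    -- Some member of the independent set blocks the first colouring in `un`; as no attached vertex
    -- does, it is among the remaining ones.
    choose : ∀ {ch r₀ rem ss} un → State ch (r₀ ∷ rem) ss un →
      ∃ λ r → r ∈ r₀ ∷ rem × row r bs ∈ rainbowRows q ss un
    choose [] S = _ , here refl , All.head (State.candidates S)
    choose {ch} {r₀} {rem} (cs ∷ un) S with All.head (State.unhit S)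
    ... | C , nr with rainbow-exists {cs = cs} (State.independent S) (State.uncolourable S) C
    ...   | i , m , e with ∈-++⁻ (r₀ ∷ rem) m
    ...     | inj₁ m′ = i , m′ , ∈-keep (All.lookup (State.candidates S) m′) e
    ...     | inj₂ m′ = ⊥-elim (true≢false e (All.lookup nr m′))

    -- The independent set is taken in the order dictated by the colourings: at each stage the
    -- vertex from `choose` selects the branch to follow.
    attach-sound : ∀ k ch rem ss un → length rem ≡ k → State ch rem ss un →
      ∃ λ zs → zs ↭ (rem ++ ch) ++ bs × induced zs ∈ attach q base k (length ch) ss un (induced (ch ++ bs))
    attach-sound zero ch [] ss [] _ S = ch ++ bs , ↭-refl , here refl
    attach-sound zero ch [] ss (cs ∷ un) _ S with All.head (State.unhit S)
    ... | C , nr with rainbow-exists {cs = cs} (State.independent S) (State.uncolourable S) C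
    ...   | i , m , e = ⊥-elim (true≢false e (All.lookup nr m))
    attach-sound (suc k) ch rem@(_ ∷ _) ss un l S with choose un S
    ... | r , r∈ , s∈ with ∈-↭ r∈
    ...   | rem′ , π = zs , ↭-trans ρ (++⁺ʳ bs (↭-sym σ))
        , ∈-concatMap⁺ _ (Any.map (λ { refl → subst (λ z → induced zs ∈ attach q base k _ _ _ (z ∷ _)) eq m }) s∈)
      where
      σ : rem ++ ch ↭ rem′ ++ r ∷ ch
      σ = ↭-trans (++⁺ʳ ch π) (↭-sym (shift r rem′ ch))
      ind : Independent (r ∷ rem′ ++ ch)
      ind = Independent-↭ (++⁺ʳ ch π) (State.independent S)
      apart : ∀ {x} → x ∈ rem′ ++ ch → Apart r x
      apart m with a ∷ _ ← ind = All.lookup a m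
      eq : row r (ch ++ bs) ≡ replicate (length ch) false ++ row r bs
      eq = row-apart r ch bs (All.tabulate λ m → apart (∈-++⁺ʳ rem′ m))
      S′ : State (r ∷ ch) rem′ (keep (λ t → not (edgeWithin base (row r bs) t)) ss)
             (keep (λ cs → not (rainbow q (row r bs) cs)) un)
      S′ = record
        { independent = Independent-↭ σ (State.independent S)
        ; uncolourable = NotColourable-↭ (++⁺ʳ bs σ) (State.uncolourable S)
        ; candidates = All.tabulate λ {r′} m →
            ∈-keep (All.lookup (State.candidates S) (∈-resp-↭ (↭-sym π) (there m)))
              (cong not (refute λ e →
                let (x , y , xy , rx , r′x , ry , r′y) = edgeWithin-sound (r ~_) (r′ ~_) bs e
                in proj₁ (apart (∈-++⁺ˡ m)) (J xy (~-sym rx) (~-sym r′x) (~-sym ry) (~-sym r′y))))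
        ; unhit = All.tabulate λ {cs} m →
            let (m′ , e) = keep-∈ (λ cs → not (rainbow q (row r bs) cs)) un m ; (C , a) = All.lookup (State.unhit S) m′
            in C , not-true e ∷ a
        }
      rest = attach-sound k (r ∷ ch) rem′ _ _ (suc-injective (trans (≡-sym (↭-length π)) l)) S′
      zs = proj₁ rest
      ρ = proj₁ (proj₂ rest)
      m = proj₂ (proj₂ rest)

    completions-sound : ∀ is → Independent is → Unique (is ++ bs) → NotColourable q (is ++ bs) →
      ∃ λ zs → zs ↭ is ++ bs × induced zs ∈ completions q (length is) base
    completions-sound is I U N with any (λ cs → not (any (λ s → rainbow q s cs) (feasible base))) (colourings q base) in e
    ... | true = ⊥-elim (let (cs , m , e′) = any-∈ _ (colourings q base) e
                             (i , i∈ , t) = rainbow-exists {cs = cs} I N (colourings-sound q bs m)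
                         in true≢false (any-intro (candidate i∈) t) (not-true e′))
      where
      candidate : ∀ {i} → i ∈ is → row i bs ∈ feasible base
      candidate i∈ = feasible-complete _ bs (Unique-at is i∈ U)
    ... | false = zs , subst (λ l → zs ↭ l ++ bs) (++-identityʳ is) ρ , m
      where
      candidate : ∀ {i} → i ∈ is → row i bs ∈ feasible base
      candidate i∈ = feasible-complete _ bs (Unique-at is i∈ U)
      rest = attach-sound (length is) [] is (feasible base) (colourings q base) refl (record
        { independent = subst Independent (≡-sym (++-identityʳ is)) I
        ; uncolourable = subst (λ l → NotColourable q (l ++ bs)) (≡-sym (++-identityʳ is)) N
        ; candidates = All.tabulate candidate
        ; unhit = All.tabulate λ m → colourings-sound q bs m , [] })
      zs = proj₁ rest
      ρ = proj₁ (proj₂ rest)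
      m = proj₂ (proj₂ rest)

-- Search around a vertex of minimum degree

size : Row → ℕ
size [] = 0
size (true ∷ r) = suc (size r)
size (false ∷ r) = size r

-- Two neighbours of `v` with rows `r` and `s` over the placed vertices, `v` included. If adjacent,
-- they have `v` as common neighbour and may have no second one. If not, they may share no edge, and
-- a missed common independent triple would complete an independent 5-set.
compatible : Tri → Row → Bool → Row → Bool
compatible g r true s = not (meetsTwice r s)
compatible g r false s = not (edgeWithin g r s ∨ independentOutside 3 g r s)

-- A row above all candidates, together with the candidate rows.
Candidates : Set
Candidates = Row × List Row

advance : Tri → Row → Row → List Candidates → List Candidates
advance g r (b ∷ p) ((u , F) ∷ Fs) = (b ∷ u , map (b ∷_) (keep (compatible g r b) F)) ∷ advance g r p Fs
advance g r _ _ = []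

-- Exact adjacencies among the unplaced neighbours, followed by upper bounds for those to the placed
-- vertices. With the placed part this is a graph containing every completion of the branch.
bounds : Tri → List Candidates → Tri
bounds (p ∷ ps) ((u , _) ∷ Fs) = (p ++ u) ∷ bounds ps Fs
bounds _ _ = []

fourColours : List ℕ
fourColours = 0 ∷ 1 ∷ 2 ∷ 3 ∷ []

recolour : Row → List (List ℕ) → List (List ℕ)
recolour = extendAll (const fourColours)

recolourBy : Tri → List (List ℕ) → List (List ℕ)
recolourBy [] css = css
recolourBy (r ∷ g) css = recolour r (recolourBy g css)

edges : Tri → ℕ
edges = foldr (λ r m → size r + m) 0

-- The edge count merely decides which of the two sufficient tests is tried first.
finished : List (ℕ × Tri) → Tri → List (List ℕ) → Bool
finished tgt g c4 = ((45 ≤ᵇ edges g) ∧ known tgt g) ∨ (not (null c4) ∨ known tgt g)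

-- `c4` lists colourings of the placed vertices for the final test. `c3` lists those using three
-- colours on the non-neighbours of `v`: in the bounding graph an unplaced neighbour is joined to
-- all of these, so it needs a colour absent there.
search : List (ℕ × Tri) → Tri → List (List ℕ) → List (List ℕ) → Tri → List Candidates → Bool
resume : List (ℕ × Tri) → Tri → List (List ℕ) → List (List ℕ) → Tri → List Candidates → Bool

search tgt g c3 c4 [] _ = finished tgt g c4
search tgt g c3 c4 (p ∷ ps) [] = false
search tgt g c3 c4 (p ∷ ps) ((_ , F) ∷ Fs) =
  all (λ r → resume tgt (r ∷ g) (recolour r c3) (recolour r c4) ps (advance g r p Fs)) F

resume tgt g c3 c4 ps Fs = any (null ∘ proj₂) Fs ∨ (not (null (recolourBy (bounds ps Fs) c3)) ∨ search tgt g c3 c4 ps Fs)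

-- The degree of a neighbour of `v` is its degree `m` among the neighbours, plus `size s`, plus one
-- for `v`; it must reach the minimum degree `d`.
initial : ℕ → Tri → List Row → ℕ → Candidates
initial d R F m = true ∷ map (const true) R , map (true ∷_) (keep (λ s → d ≤ᵇ suc (m + size s)) F)

searchFrom : List (ℕ × Tri) → List Row → List (List ℕ) → List (List ℕ) → Tri → Tri → Bool
searchFrom tgt F c3 c4 R N = search tgt (map (const false) R ∷ R)
  (recolour (map (const false) R) c3) (recolour (map (const false) R) c4) N (map (initial (length N) R F) (degrees N))

searchAll : List (ℕ × Tri) → List Tri → List Tri → Bool
searchAll tgt Ns = all (λ R → all (searchFrom tgt (feasible R) (colourings 3 R) (colourings 4 R) R) Ns)

-- Soundness of the search

null-∈ : ∀ {A : Set} {x : A} {xs} → x ∈ xs → null xs ≡ false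
null-∈ (here _) = refl
null-∈ (there _) = refl

nonempty : ∀ {A : Set} (xs : List A) → null xs ≡ false → ∃ λ x → x ∈ xs
nonempty (x ∷ _) _ = x , here refl

_⊑_ : Row → Row → Set
_⊑_ = Pointwise (λ a b → a ≡ true → b ≡ true)

clash-⊑ : ∀ c {r s} cs → r ⊑ s → clash c s cs ≡ false → clash c r cs ≡ false
clash-⊑ c {[]} cs [] e = refl
clash-⊑ c {true ∷ r} {true ∷ s} [] (_ ∷ p) e = refl
clash-⊑ c {true ∷ r} {true ∷ s} (x ∷ cs) (_ ∷ p) e with c ≡ᵇ x
... | false = clash-⊑ c cs p e
clash-⊑ c {true ∷ r} {false ∷ s} cs (h ∷ p) e = ⊥-elim (true≢false (h refl) refl)
clash-⊑ c {false ∷ r} {b ∷ s} [] (_ ∷ p) e = refl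
clash-⊑ c {false ∷ r} {false ∷ s} (x ∷ cs) (_ ∷ p) e = clash-⊑ c cs p e
clash-⊑ c {false ∷ r} {true ∷ s} (x ∷ cs) (_ ∷ p) e with c ≡ᵇ x
... | false = clash-⊑ c cs p e

⊑-++ : ∀ p {r s} → r ⊑ s → (p ++ r) ⊑ (p ++ s)
⊑-++ [] h = h
⊑-++ (b ∷ p) h = (λ e → e) ∷ ⊑-++ p h

fourColours-bound : ∀ {c} → c ∈ fourColours → c < 4
fourColours-bound (here refl) = s≤s z≤n
fourColours-bound (there (here refl)) = s≤s (s≤s z≤n)
fourColours-bound (there (there (here refl))) = s≤s (s≤s (s≤s z≤n))
fourColours-bound (there (there (there (here refl)))) = s≤s (s≤s (s≤s (s≤s z≤n)))

module Searching {n : ℕ} (G : Graph n) (J : NoJ4 G)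
  (α≤4 : ∀ is → InGraph.Independent G is → length is ≡ 5 → ⊥) where
  open InGraph G
  open InJ4FreeGraph G J
  open CatalogueIn G
  open Colouring G

  Coloured-weaken : ∀ {q q′ ws cs} → q ≤ q′ → Coloured q ws cs → Coloured q′ ws cs
  Coloured-weaken h [] = []
  Coloured-weaken h (b ∷⟨ e ⟩ C) = <-≤-trans b h ∷⟨ e ⟩ Coloured-weaken h C

  AllColoured : List V → List (List ℕ) → Set
  AllColoured ws = All (Coloured 4 ws)

  recolour-sound : ∀ {w ws r css} → row w ws ⊑ r → AllColoured ws css → AllColoured (w ∷ ws) (recolour r css)
  recolour-sound {r = r} {css} h a = All.tabulate λ m → case (extendAll-∈ (const fourColours) r css m)
    where
    case : ∀ {ds} → _ → Coloured 4 _ ds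
    case (c , cs , m , p , e , refl) = fourColours-bound p ∷⟨ clash-⊑ c cs h e ⟩ All.lookup a m

  ⊑-refl : ∀ r → r ⊑ r
  ⊑-refl [] = []
  ⊑-refl (b ∷ r) = (λ e → e) ∷ ⊑-refl r

  Entry : List V → V → Candidates → Set
  Entry cs u (b , F) = row u cs ∈ F × row u cs ⊑ b

  Entries : List V → List V → List Candidates → Set
  Entries cs = Pointwise (Entry cs)

  -- The true rows lie below the bounds, and a colouring proper for the larger rows is proper for
  -- the smaller ones.
  recolourBy-sound : ∀ {cs us Fs css} → Entries cs us Fs → AllColoured cs css →
    AllColoured (us ++ cs) (recolourBy (bounds (induced us) Fs) css)
  recolourBy-sound [] a = a
  recolourBy-sound {cs} {u ∷ us} {(b , _) ∷ _} ((_ , h) ∷ es) a = recolour-sound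
    (subst (_⊑ (row u us ++ b)) (≡-sym (map-++ (u ~_) us cs)) (⊑-++ (row u us) h)) (recolourBy-sound es a)

  not-dead : ∀ {cs us Fs} → Entries cs us Fs → any (null ∘ proj₂) Fs ≡ true → ⊥
  not-dead ((m , _) ∷ es) e rewrite null-∈ m = not-dead es e

  advance-sound : ∀ u cs us {Fs} → Unique (u ∷ us ++ cs) → Entries cs us Fs →
    Entries (u ∷ cs) us (advance (induced cs) (row u cs) (row u us) Fs)
  advance-sound u cs [] _ [] = []
  advance-sound u cs (x ∷ us) {(b , F) ∷ Fs} ((u≢x ∷ u∉) ∷ x∉ ∷ U) ((m , h) ∷ es) =
    (subst (λ a → a ∷ row x cs ∈ map (u ~ x ∷_) (keep (compatible (induced cs) (row u cs) (u ~ x)) F))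
       (~-sym refl) (∈-map⁺ (u ~ x ∷_) (∈-keep m compat))
    , (λ e → ~-sym e) ∷ h) ∷ advance-sound u cs us (u∉ ∷ U) es
    where
    no-edge : edgeWithin (induced cs) (row u cs) (row x cs) ≡ true → ⊥
    no-edge e = let (y , z , yz , uy , xy , uz , xz) = edgeWithin-sound (u ~_) (x ~_) cs e
      in u≢x (J yz (~-sym uy) (~-sym xy) (~-sym uz) (~-sym xz))
    no-gap : u ~ x ≡ false → independentOutside 3 (induced cs) (row u cs) (row x cs) ≡ true → ⊥
    no-gap ux e = let (is , l , i , a) = independentOutside-sound 3 (u ~_) (x ~_) cs (Unique-++ʳ us U) e
      in α≤4 (u ∷ x ∷ is)
           (((u≢x , ux) ∷ All.map (λ (m , p , _) → All.lookup u∉ (∈-++⁺ʳ us m) , p) a)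
            ∷ All.map (λ (m , _ , p) → All.lookup x∉ (∈-++⁺ʳ us m) , p) a ∷ i)
           (cong (λ k → suc (suc k)) l)
    compat : compatible (induced cs) (row u cs) (u ~ x) (row x cs) ≡ true
    compat with u ~ x in ux
    ... | true = cong not (refute λ e →
      let (y , z , _ , _ , y≢z , uy , xy , uz , xz) = meetsTwice-sound (u ~_) (x ~_) cs (Unique-++ʳ us U) e
      in y≢z (J ux uy uz xy xz))
    ... | false = cong not (refute λ e →
      [ no-edge , no-gap ux ]′ (∨-true {edgeWithin (induced cs) (row u cs) (row x cs)} e))

  Found : List Tri → List V → Set
  Found tgt xs = ∃ λ zs → zs ↭ xs × induced zs ∈ tgt

  -- Follows the branch in which each neighbour receives its true row. This row survives every
  -- filter, and since the graph is not 4-colourable the branch can only end in a listed target.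
  search-sound : ∀ tgt us cs Fs c3 c4 → Unique (us ++ cs) → NotColourable 4 (us ++ cs) → Entries cs us Fs →
    AllColoured cs c3 → AllColoured cs c4 →
    search (keyed tgt) (induced cs) c3 c4 (induced us) Fs ≡ true → Found tgt (us ++ cs)
  search-sound tgt [] cs Fs c3 c4 U N es a3 a4 e =
    ≅∈-permutation cs (lookFor-sound (key (induced cs)) (induced cs) tgt (finish e))
    where
    finish : finished (keyed tgt) (induced cs) c4 ≡ true → known (keyed tgt) (induced cs) ≡ true
    finish e with ∨-true {(45 ≤ᵇ edges (induced cs)) ∧ known (keyed tgt) (induced cs)} e
    ... | inj₁ e′ = proj₂ (∧-true {45 ≤ᵇ edges (induced cs)} e′)
    ... | inj₂ e′ with ∨-true {not (null c4)} e′
    ...   | inj₂ k = k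
    ...   | inj₁ k = ⊥-elim (N _ (coloured-proper (All.lookup a4 (proj₂ (nonempty c4 (not-true k))))))
  search-sound tgt (u ∷ us) cs ((b , F) ∷ Fs) c3 c4 U N ((m , _) ∷ es) a3 a4 e
    with ∨-true {any (null ∘ proj₂) (advance (induced cs) (row u cs) (row u us) Fs)} (all-∈ e m)
  ... | inj₁ dead = ⊥-elim (not-dead (advance-sound u cs us U es) dead)
  ... | inj₂ e′ with ∨-true {not (null (recolourBy (bounds (induced us) (advance (induced cs) (row u cs) (row u us) Fs)) (recolour (row u cs) c3)))} e′
  ...   | inj₁ c = ⊥-elim (NotColourable-↭ (↭-sym (shift u us cs)) N _
            (coloured-proper (All.lookup
              (recolourBy-sound (advance-sound u cs us U es) (recolour-sound (⊑-refl _) a3))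
              (proj₂ (nonempty _ (not-true c))))))
  ...   | inj₂ e″ =
    let (zs , π , z) = search-sound tgt us (u ∷ cs) _ _ _
          (Unique-↭ (↭-sym (shift u us cs)) U) (NotColourable-↭ (↭-sym (shift u us cs)) N)
          (advance-sound u cs us U es)
          (recolour-sound (⊑-refl _) a3) (recolour-sound (⊑-refl _) a4) e″
    in zs , ↭-trans π (shift u us cs) , z

  blank : ∀ v rs → All (λ x → v ~ x ≡ false) rs → row v rs ≡ map (const false) (induced rs)
  blank v [] [] = refl
  blank v (x ∷ rs) (e ∷ es) = cong₂ _∷_ e (blank v rs es)

  ⊑-full : ∀ u rs → row u rs ⊑ map (const true) (induced rs)
  ⊑-full u [] = []
  ⊑-full u (x ∷ rs) = (λ _ → refl) ∷ ⊑-full u rs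

  degrees-induced : ∀ us → degrees (induced us) ≡ map (λ u → size (row u us)) us
  degrees-induced [] = refl
  degrees-induced (w ∷ ws) = cong₂ _∷_ (trans (head ws) (≡-sym loop)) (trans (cong (addAt 1 (row w ws)) (degrees-induced ws)) (tail ws))
    where
    loop : size (row w (w ∷ ws)) ≡ size (row w ws)
    loop rewrite irrefl G w = refl
    head : ∀ xs → weightAt (row w xs) (map (const 1) (induced xs)) ≡ size (row w xs)
    head [] = refl
    head (x ∷ xs) with w ~ x
    ... | true = cong suc (head xs)
    ... | false = head xs
    tail : ∀ xs → addAt 1 (row w xs) (map (λ u → size (row u ws)) xs) ≡ map (λ u → size (row u (w ∷ ws))) xs
    tail [] = refl
    tail (x ∷ xs) with w ~ x in e
    ... | true rewrite ~-sym e = cong (_ ∷_) (tail xs)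
    ... | false rewrite ~-sym e = cong (_ ∷_) (tail xs)

  searchAll-sound : ∀ tgt v us rs Ns Rs → Unique (v ∷ us ++ rs) → NotColourable 4 (v ∷ us ++ rs) →
    All (λ u → v ~ u ≡ true) us → All (λ x → v ~ x ≡ false) rs →
    All (λ u → length us ≤ suc (size (row u us) + size (row u rs))) us →
    induced us ∈ Ns → induced rs ∈ Rs → searchAll (keyed tgt) Ns Rs ≡ true → Found tgt (v ∷ us ++ rs)
  searchAll-sound tgt v us rs Ns Rs U N vu vr deg m m′ e =
    let (zs , π , z) = search-sound tgt us (v ∷ rs) _ _ _
          (Unique-↭ (↭-sym (shift v us rs)) U) (NotColourable-↭ (↭-sym (shift v us rs)) N) entries
          (coloured 3 (s≤s (s≤s (s≤s z≤n)))) (coloured 4 (s≤s (s≤s (s≤s (s≤s z≤n)))))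
          (subst (λ r → search (keyed tgt) (r ∷ R) _ _ (induced us) _ ≡ true) (≡-sym (blank v rs vr)) (all-∈ (all-∈ e m′) m))
    in zs , ↭-trans π (shift v us rs) , z
    where
    R = induced rs
    coloured : ∀ q → q ≤ 4 → AllColoured (v ∷ rs) (recolour (map (const false) R) (colourings q R))
    coloured q h = recolour-sound (subst (row v rs ⊑_) (blank v rs vr) (⊑-refl (row v rs)))
      (All.tabulate λ m → Coloured-weaken h (colourings-sound q rs m))
    entry : ∀ {u} → u ∈ us → Entry (v ∷ rs) u (initial (length (induced us)) R (feasible R) (size (row u us)))
    entry {u} u∈ rewrite ~-sym (All.lookup vu u∈) =
      ∈-map⁺ (true ∷_) (∈-keep (feasible-complete u rs (Unique-at us u∈ (Unique-++ʳ (v ∷ []) U))) large)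
      , (λ _ → refl) ∷ ⊑-full u rs
      where
      large : (length (induced us) ≤ᵇ suc (size (row u us) + size (row u rs))) ≡ true
      large rewrite length-induced us = Equivalence.to T-≡ (≤⇒≤ᵇ (All.lookup deg u∈))
    entries : Entries (v ∷ rs) us (map (initial (length (induced us)) R (feasible R)) (degrees (induced us)))
    entries rewrite degrees-induced us = pointwise us (All.tabulate entry)
      where
      pointwise : ∀ xs → All (λ u → Entry (v ∷ rs) u (initial (length (induced us)) R (feasible R) (size (row u us)))) xs →
        Entries (v ∷ rs) xs (map (initial (length (induced us)) R (feasible R)) (map (λ u → size (row u us)) xs))
      pointwise [] [] = []
      pointwise (x ∷ xs) (p ∷ ps) = p ∷ pointwise xs ps

-- Catalogues up to isomorphism, by number of vertices: J₄-free graphs without independent 4-set, neighbourhoods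
-- in J₄-free graphs without independent 5-set, and all J₄-free graphs on at most 6 vertices.
sparseCodes : ℕ → List ℕ
sparseCodes 0 =
  0 ∷ []
sparseCodes 1 =
  0 ∷ []
sparseCodes 2 =
  0 ∷ 1 ∷ []
sparseCodes 3 =
  0 ∷ 1 ∷ 3 ∷ 7 ∷ []
sparseCodes 4 =
  1 ∷ 3 ∷ 7 ∷ 33 ∷ 19 ∷ 11 ∷ 15 ∷ 51 ∷ []
sparseCodes 5 =
  129 ∷ 515 ∷ 35 ∷ 71 ∷ 19 ∷ 23 ∷ 31 ∷ 291 ∷ 163 ∷ 171 ∷ 87 ∷ 126 ∷ 531 ∷ 535 ∷ 543 ∷ 803 ∷ 599 ∷ []
sparseCodes 6 =
  16897 ∷ 16451 ∷ 4131 ∷ 16423 ∷ 2183 ∷ 4135 ∷ 8239 ∷ 4143 ∷ 4159 ∷ 12323 ∷ 9283 ∷ 20519 ∷ 16963 ∷ 9351 ∷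
  24623 ∷ 903 ∷ 8359 ∷ 4399 ∷ 5187 ∷ 5203 ∷ 843 ∷ 4263 ∷ 4279 ∷ 2215 ∷ 16750 ∷ 3271 ∷ 1747 ∷ 3197 ∷ 25667 ∷
  24743 ∷ 3407 ∷ 9607 ∷ 6311 ∷ 14503 ∷ 10478 ∷ 26862 ∷ 28707 ∷ 17287 ∷ 10955 ∷ 30887 ∷ []
sparseCodes 7 =
  1081411 ∷ 1081415 ∷ 1081423 ∷ 589903 ∷ 1081439 ∷ 1081471 ∷ 622659 ∷ 1343559 ∷ 1085571 ∷ 401671 ∷ 1638479 ∷
  527111 ∷ 590151 ∷ 1081935 ∷ 265743 ∷ 1081671 ∷ 590415 ∷ 1082463 ∷ 49743 ∷ 360515 ∷ 360547 ∷ 264967 ∷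
  264999 ∷ 1082958 ∷ 281351 ∷ 1061255 ∷ 281693 ∷ 1082959 ∷ 591438 ∷ 287111 ∷ 272803 ∷ 1069277 ∷ 141707 ∷
  141723 ∷ 84379 ∷ 141755 ∷ 591439 ∷ 76171 ∷ 76203 ∷ 140766 ∷ 1837187 ∷ 1575687 ∷ 1642627 ∷ 1638727 ∷
  1069711 ∷ 1575563 ∷ 344391 ∷ 549519 ∷ 115279 ∷ 1089863 ∷ 606799 ∷ 217739 ∷ 1190283 ∷ 600459 ∷ 1098319 ∷
  58895 ∷ 221579 ∷ 1220935 ∷ 631111 ∷ 639319 ∷ 1188302 ∷ 185111 ∷ 567731 ∷ 142747 ∷ 106855 ∷ 246347 ∷
  217677 ∷ 442711 ∷ 143119 ∷ 626931 ∷ 142685 ∷ 368967 ∷ 368999 ∷ 333550 ∷ 1679687 ∷ 1647054 ∷ 1000015 ∷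
  112423 ∷ 668303 ∷ 1649035 ∷ 1716879 ∷ 335655 ∷ []
sparseCodes 8 =
  139198595 ∷ 48234631 ∷ 235143311 ∷ 138421767 ∷ 50342927 ∷ 138426399 ∷ 138427406 ∷ 33915715 ∷ 138463495 ∷
  138609053 ∷ 67569821 ∷ 5384475 ∷ 134783755 ∷ 134783787 ∷ 35791675 ∷ 138427407 ∷ 33950863 ∷ 134764958 ∷
  134763950 ∷ 17861534 ∷ 17863614 ∷ 235159811 ∷ 235143815 ∷ 209724935 ∷ 138609935 ∷ 137413899 ∷ 141591175 ∷
  136922379 ∷ 202416907 ∷ 18500119 ∷ 139264647 ∷ 76939927 ∷ 36048015 ∷ 201655439 ∷ 134646799 ∷ 7473311 ∷
  136938251 ∷ 26085527 ∷ 78676615 ∷ 151847575 ∷ 20006423 ∷ 140550947 ∷ 85262999 ∷ 136660503 ∷ 22676655 ∷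
  84970398 ∷ 18139411 ∷ 18236723 ∷ 35793691 ∷ 134773019 ∷ 19219763 ∷ 151298867 ∷ 71639859 ∷ 6899303 ∷
  134772011 ∷ 9308823 ∷ 72373678 ∷ 72371662 ∷ 17983283 ∷ 52707763 ∷ 50733875 ∷ 139231879 ∷ 139231911 ∷
  139231975 ∷ 138958254 ∷ 138956206 ∷ 51416030 ∷ 10668823 ∷ 89203979 ∷ 89719431 ∷ 210535047 ∷ 44648007 ∷
  139236007 ∷ 22581927 ∷ 75805995 ∷ 118784647 ∷ 210814223 ∷ 85542029 ∷ 156828815 ∷ 119621919 ∷ 57213575 ∷
  176726795 ∷ 172819143 ∷ 21543211 ∷ 76052007 ∷ 176980679 ∷ 22581675 ∷ 84438567 ∷ 84438189 ∷ 13679695 ∷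
  219188126 ∷ 138540333 ∷ 42625875 ∷ 9043021 ∷ 6974637 ∷ 75704316 ∷ 152093967 ∷ 85542155 ∷ 210281227 ∷
  60917007 ∷ 51252367 ∷ 210262430 ∷ 185402511 ∷ 61408399 ∷ 76418191 ∷ 84438315 ∷ 75805491 ∷ 210260918 ∷
  76662599 ∷ 39012167 ∷ 6974763 ∷ 76705303 ∷ 49316551 ∷ 138966567 ∷ 138964519 ∷ 253002375 ∷ 252740494 ∷
  210635415 ∷ 156285967 ∷ 210635919 ∷ 42677775 ∷ 6966702 ∷ 219759757 ∷ 210635163 ∷ 137284907 ∷ 141192365 ∷
  137221293 ∷ 141192491 ∷ []
sparseCodes 9 =
  60202942723 ∷ 60196686855 ∷ 35437156367 ∷ 35484206603 ∷ 60133901835 ∷ 34544618519 ∷ 1630609971 ∷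
  8691692059 ∷ 35437156623 ∷ 4915997486 ∷ 34498514627 ∷ 40947025159 ∷ 20019677455 ∷ 4916288043 ∷ 4920255011 ∷
  18363255879 ∷ 34565448235 ∷ 4916029995 ∷ 34501825815 ∷ 12113236766 ∷ 10205892195 ∷ 1309977163 ∷
  4601779763 ∷ 35574384323 ∷ 19329963093 ∷ 4579271975 ∷ 34500138588 ∷ 2341149831 ∷ 1766213454 ∷ 4920547629 ∷
  60203074823 ∷ 60203074855 ∷ 60200921902 ∷ 35573471006 ∷ 22836417815 ∷ 62415603211 ∷ 60200954919 ∷
  35575568655 ∷ 54379415823 ∷ 19679991823 ∷ 19469183247 ∷ 60202100263 ∷ 19638423083 ∷ 19611789583 ∷
  53968439819 ∷ 54505244943 ∷ 54232820239 ∷ 64701532687 ∷ 45238719767 ∷ 53823579699 ∷ 38936080415 ∷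
  39881086487 ∷ 39880312343 ∷ 55304524047 ∷ 51628284718 ∷ 10239911483 ∷ 36281390878 ∷ 13510482221 ∷
  11081665163 ∷ 60197939757 ∷ 35449037339 ∷ 53689701461 ∷ 10912142727 ∷ 20955899443 ∷ 10908510763 ∷
  2311932301 ∷ 1768310087 ∷ 4920547883 ∷ 35112137243 ∷ 3660753451 ∷ 35128874263 ∷ 3664816427 ∷ 22837466391 ∷
  53829179663 ∷ 20023086375 ∷ 36281424911 ∷ 21900038939 ∷ 35207683642 ∷ 51891020587 ∷ 35071503411 ∷
  36143148047 ∷ 2402700391 ∷ 30690351405 ∷ 20096102671 ∷ 53763975695 ∷ 51628317227 ∷ 53829178647 ∷
  36129215767 ∷ 13510482475 ∷ 51891021095 ∷ 19960171815 ∷ 34992368179 ∷ 21110762511 ∷ 30690351659 ∷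
  30625438251 ∷ 65050089773 ∷ 64984918317 ∷ 65050090027 ∷ []
sparseCodes 10 =
  28734575227947 ∷ 33305629186063 ∷ 18505291915295 ∷ 29284331041835 ∷ 33270114047027 ∷ []
sparseCodes _ = []

matchedCodes : ℕ → List ℕ
matchedCodes 0 =
  0 ∷ []
matchedCodes 1 =
  0 ∷ []
matchedCodes 2 =
  0 ∷ 1 ∷ []
matchedCodes 3 =
  0 ∷ 1 ∷ []
matchedCodes 4 =
  0 ∷ 4 ∷ 18 ∷ []
matchedCodes 5 =
  1 ∷ 34 ∷ []
matchedCodes 6 =
  9216 ∷ 16897 ∷ []
matchedCodes 7 =
  264193 ∷ []
matchedCodes 8 =
  138420225 ∷ []
matchedCodes _ = []

smallCodes : ℕ → List ℕ
smallCodes 0 =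
  0 ∷ []
smallCodes 1 =
  0 ∷ []
smallCodes 2 =
  0 ∷ 1 ∷ []
smallCodes 3 =
  0 ∷ 1 ∷ 3 ∷ 7 ∷ []
smallCodes 4 =
  0 ∷ 1 ∷ 3 ∷ 7 ∷ 33 ∷ 19 ∷ 11 ∷ 15 ∷ 51 ∷ []
smallCodes 5 =
  0 ∷ 1 ∷ 3 ∷ 7 ∷ 15 ∷ 129 ∷ 515 ∷ 35 ∷ 71 ∷ 19 ∷ 23 ∷ 31 ∷ 291 ∷ 163 ∷ 171 ∷ 87 ∷ 126 ∷ 531 ∷ 535 ∷ 543 ∷
  803 ∷ 599 ∷ []
smallCodes 6 =
  0 ∷ 1 ∷ 3 ∷ 7 ∷ 15 ∷ 31 ∷ 513 ∷ 4099 ∷ 16391 ∷ 67 ∷ 135 ∷ 271 ∷ 35 ∷ 39 ∷ 47 ∷ 63 ∷ 390 ∷ 1091 ∷ 2093 ∷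
  579 ∷ 587 ∷ 603 ∷ 391 ∷ 167 ∷ 303 ∷ 366 ∷ 238 ∷ 254 ∷ 510 ∷ 16897 ∷ 16451 ∷ 4131 ∷ 16423 ∷ 2183 ∷ 4135 ∷
  8239 ∷ 4143 ∷ 4159 ∷ 12323 ∷ 9283 ∷ 20519 ∷ 16963 ∷ 9351 ∷ 24623 ∷ 903 ∷ 8359 ∷ 4399 ∷ 5187 ∷ 5203 ∷ 843 ∷
  4263 ∷ 4279 ∷ 2215 ∷ 16750 ∷ 3271 ∷ 1747 ∷ 3197 ∷ 25667 ∷ 24743 ∷ 3407 ∷ 9607 ∷ 6311 ∷ 14503 ∷ 10478 ∷
  26862 ∷ 28707 ∷ 17287 ∷ 10955 ∷ 30887 ∷ []
smallCodes _ = []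

-- The J₄-free graphs on 10 vertices that are not 3-colourable and have an independent 4-set.
tenCodes : List ℕ
tenCodes =
  28653434490 ∷ 509696166451 ∷ 700415694650 ∷ 732393097050 ∷ 1178119180083 ∷ 1215781026063 ∷ 1224390743851 ∷
  1244702971843 ∷ 1687154939726 ∷ 1721531640647 ∷ 1792160795987 ∷ 1792361977646 ∷ 1795483776043 ∷
  2083186022091 ∷ 2371994736869 ∷ 2476114114804 ∷ 2483904538837 ∷ 2981283117135 ∷ 3652015624131 ∷
  3655322449935 ∷ 4443448956943 ∷ 4443448957199 ∷ 4718210846563 ∷ 4718227773455 ∷ 4718227773711 ∷
  5569780872556 ∷ 5578329961231 ∷ 5613827537167 ∷ 5640577591637 ∷ 5682444064043 ∷ 5682445758238 ∷
  5780189489043 ∷ 6189128572220 ∷ 6190408488750 ∷ 6194586858029 ∷ 6917350119439 ∷ 7186877532967 ∷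
  7427241381558 ∷ 7427627472558 ∷ 8994232395386 ∷ 9913073875157 ∷ 10005294589850 ∷ 10011874048271 ∷
  10519550728078 ∷ 10586207824775 ∷ 10591576798251 ∷ 15584593732623 ∷ 15713443141647 ∷ 16777385495085 ∷
  17713821345514 ∷ 18264924264527 ∷ 18505342955551 ∷ 22597270528783 ∷ 27604060092687 ∷ 27610774019694 ∷
  28183762842667 ∷ []

-- The last four arise from the first by deleting the edges 0–5; 0–5, 1–3; 0–5, 12–13; 0–5, 1–3, 2–4.
targetCodes : List ℕ
targetCodes =
  38397402797828370486152999002451 ∷ 38397402797828370486152999002435 ∷ 38397402797828370486152998969667 ∷
  33326800396915452880166186180931 ∷ 38397402797828370486152730534211 ∷ []

-- The decoded catalogues and their verification by computation

sparseAt matchedAt smallAt : ℕ → List Tri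
sparseAt n = map (decode n) (sparseCodes n)
matchedAt n = map (decode n) (matchedCodes n)
smallAt n = map (decode n) (smallCodes n)

ten targets : List Tri
ten = map (decode 10) tenCodes
targets = map (decode 15) targetCodes

-- Cutting off the candidates beyond five vertices makes the catalogue closed although it ends at
-- six.
small : Tri → List Row
small g = if length g ≤ᵇ 5 then feasible g else []

sparse-closed : ∀ n → covers (keyed (sparseAt (suc n))) sparse (sparseAt n) ≡ true
sparse-closed 0 = refl
sparse-closed 1 = refl
sparse-closed 2 = refl
sparse-closed 3 = refl
sparse-closed 4 = refl
sparse-closed 5 = refl
sparse-closed 6 = refl
sparse-closed 7 = refl
sparse-closed 8 = refl
sparse-closed 9 = refl
-- `sparseAt 11` is empty, so this case shows that no listed graph on ten vertices extends: without
-- independent 4-set a J₄-free graph has at most ten vertices.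
sparse-closed 10 = refl
sparse-closed (suc (suc (suc (suc (suc (suc (suc (suc (suc (suc (suc _))))))))))) = refl

matched-closed : ∀ n → covers (keyed (matchedAt (suc n))) matched (matchedAt n) ≡ true
matched-closed 0 = refl
matched-closed 1 = refl
matched-closed 2 = refl
matched-closed 3 = refl
matched-closed 4 = refl
matched-closed 5 = refl
matched-closed 6 = refl
matched-closed 7 = refl
-- `matchedAt 9` is empty: a matching on nine vertices has an independent 5-set, so degrees are at
-- most 8.
matched-closed 8 = refl
matched-closed (suc (suc (suc (suc (suc (suc (suc (suc (suc _))))))))) = refl

small-closed : ∀ n → covers (keyed (smallAt (suc n))) small (smallAt n) ≡ true
small-closed 0 = refl
small-closed 1 = refl
small-closed 2 = refl
small-closed 3 = refl
small-closed 4 = refl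
small-closed 5 = refl
small-closed 6 = refl
small-closed (suc (suc (suc (suc (suc (suc (suc _))))))) = refl

record Recognised (q k : ℕ) (gs tgt : List Tri) : Set where
  field holds : all (λ g → all (known (keyed tgt)) (completions q k g)) gs ≡ true

completions-small : Recognised 3 4 (smallAt 6) ten
completions-small = record { holds = refl }

completions-ten : Recognised 4 5 ten targets
completions-ten = record { holds = refl }

completions-sparse : Recognised 4 5 (sparseAt 10) targets
completions-sparse = record { holds = refl }

search-succeeds : ∀ d {N} → N ∈ matchedAt d →
  searchAll (keyed targets) (matchedAt d) (sparseAt (14 ∸ d)) ≡ true
-- For `d` up to 3 there would be at least eleven non-neighbours, for which the catalogue is empty.
-- The genuine searches are those for `d` from 4 to 8.
search-succeeds 0 _ = refl
search-succeeds 1 _ = refl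
search-succeeds 2 _ = refl
search-succeeds 3 _ = refl
search-succeeds 4 _ = refl
search-succeeds 5 _ = refl
search-succeeds 6 _ = refl
search-succeeds 7 _ = refl
search-succeeds 8 _ = refl
search-succeeds (suc (suc (suc (suc (suc (suc (suc (suc (suc _))))))))) ()

-- Classification on 15 vertices

keep-split : ∀ {A : Set} {p : A → Bool} xs → xs ↭ keep p xs ++ keep (not ∘ p) xs
keep-split [] = ↭-refl
keep-split {p = p} (x ∷ xs) with p x
... | true = prep x (keep-split xs)
... | false = ↭-trans (prep x (keep-split xs)) (↭-sym (shift x (keep p xs) _))

size-++ : ∀ r s → size (r ++ s) ≡ size r + size s
size-++ [] s = refl
size-++ (true ∷ r) s = cong suc (size-++ r s)
size-++ (false ∷ r) s = size-++ r s

size-↭ : ∀ {A : Set} (f : A → Bool) {xs ys} → xs ↭ ys → size (map f xs) ≡ size (map f ys)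
size-↭ f _↭_.refl = refl
size-↭ f (prep x π) with f x
... | true = cong suc (size-↭ f π)
... | false = size-↭ f π
size-↭ f (swap x y π) with f x | f y
... | true | true = cong (λ k → suc (suc k)) (size-↭ f π)
... | true | false = cong suc (size-↭ f π)
... | false | true = cong suc (size-↭ f π)
... | false | false = size-↭ f π
size-↭ f (_↭_.trans π ρ) = trans (size-↭ f π) (size-↭ f ρ)

size-all : ∀ {A : Set} (f : A → Bool) xs → All (λ x → f x ≡ true) xs → size (map f xs) ≡ length xs
size-all f [] [] = refl
size-all f (x ∷ xs) (e ∷ es) rewrite e = cong suc (size-all f xs es)

size-none : ∀ {A : Set} (f : A → Bool) xs → All (λ x → f x ≡ false) xs → size (map f xs) ≡ 0
size-none f [] [] = refl
size-none f (x ∷ xs) (e ∷ es) rewrite e = size-none f xs es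

minimum : ∀ {A : Set} (f : A → ℕ) {k} xs → length xs ≡ suc k → ∃ λ m → All (λ y → f m ≤ f y) xs
minimum f (x ∷ []) _ = x , ≤-refl ∷ []
minimum f (x ∷ xs@(_ ∷ _)) _ with minimum f xs refl
... | m , a with ≤-total (f x) (f m)
...   | inj₁ h = x , ≤-refl ∷ All.map (≤-trans h) a
...   | inj₂ h = m , h ∷ a

-- Decides by exhaustion whether an independent 5-set exists, which is the case distinction of the
-- classification.
anyList? : ∀ {n} k {P : List (Fin n) → Set} → Decidable P → Dec (∃ λ xs → length xs ≡ k × P xs)
anyList? zero P? = map′ (λ p → [] , refl , p) (λ { ([] , _ , p) → p }) (P? [])
anyList? (suc k) P? = map′ (λ (x , xs , l , p) → x ∷ xs , cong suc l , p)
  (λ { (x ∷ xs , l , p) → x , xs , suc-injective l , p }) (any? λ x → anyList? k λ xs → P? (x ∷ xs))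

sparseCatalogue : Catalogue sparse
sparseCatalogue = record { at = sparseAt ; start = here refl ; closed = sparse-closed }

matchedCatalogue : Catalogue matched
matchedCatalogue = record { at = matchedAt ; start = here refl ; closed = matched-closed }

smallCatalogue : Catalogue small
smallCatalogue = record { at = smallAt ; start = here refl ; closed = small-closed }

recognise : ∀ {q k gs tgt g z} → Recognised q k gs tgt → g ∈ gs → z ∈ completions q k g → known (keyed tgt) z ≡ true
recognise h m c = all-∈ (all-∈ (Recognised.holds h) m) c

module Classification {n : ℕ} (G : Graph n) (J : NoJ4 G) (vertices : List (Fin n)) (unique : Unique vertices)
  (complete : ∀ x → x ∈ vertices) (fifteen : length vertices ≡ 15)
  (N : Colouring.NotColourable G 4 vertices) where
  open InGraph G
  open InJ4FreeGraph G J
  open CatalogueIn G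
  open Colouring G

  Found : Set
  Found = ∃ λ zs → zs ↭ vertices × induced zs ∈ targets

  find-small : ∀ ws → Unique ws → length ws ≤ 6 → ∃ λ ws′ → ws′ ↭ ws × induced ws′ ∈ smallAt (length ws)
  find-small ws u l = [ ⊥-elim , (λ x → x) ]′
    (find small smallCatalogue (λ ws → Unique ws × length ws ≤ 6) (const ⊥)
      (λ { (_ ∷ u , l) → u , <⇒≤ l }) (λ ()) step ws (u , l))
    where
    step : ∀ {w ws ws′} → Unique (w ∷ ws) × length (w ∷ ws) ≤ 6 → ws′ ↭ ws → ⊥ ⊎ row w ws′ ∈ small (induced ws′)
    step {w} {ws} {ws′} (u , s≤s l) π = inj₂ (subst (row w ws′ ∈_) (≡-sym short)
        (feasible-complete w ws′ (Unique-↭ (prep w (↭-sym π)) u)))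
      where
      short : small (induced ws′) ≡ feasible (induced ws′)
      short rewrite Equivalence.to T-≡ (≤⇒≤ᵇ (subst (_≤ 5)
        (trans (≡-sym (↭-length π)) (≡-sym (length-induced ws′))) l)) = refl

  open DecMembership (_≟_ {n}) using (_∈?_)

  apart-in : ∀ {is x y} → Independent is → x ∈ is → y ∈ is → x ~ y ≡ false
  apart-in {x = x} (a ∷ i) (here refl) (here refl) = irrefl G x
  apart-in (a ∷ i) (here refl) (there m) = proj₂ (All.lookup a m)
  apart-in (a ∷ i) (there m) (here refl) = ~-sym (proj₂ (All.lookup a m))
  apart-in (a ∷ i) (there m) (there m′) = apart-in i m m′

  -- A colouring of the rest extends by giving the whole independent set the new colour `q`.
  remove-independent : ∀ {q is ws} → Independent is → NotColourable (suc q) (is ++ ws) → NotColourable q ws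
  remove-independent {q} {is} {ws} I h f (b , p) = h f′ ((λ {x} → bound x) , λ {x} {y} → distinct x y)
    where
    f′ : V → ℕ
    f′ x with x ∈? is
    ... | yes _ = q
    ... | no _ = f x
    rest : ∀ {x} → x ∈ is ++ ws → x ∉ is → x ∈ ws
    rest m h = [ (λ m′ → ⊥-elim (h m′)) , (λ m′ → m′) ]′ (∈-++⁻ is m)
    bound : ∀ x → x ∈ is ++ ws → f′ x < suc q
    bound x m with x ∈? is
    ... | yes _ = n<1+n q
    ... | no h = m≤n⇒m≤1+n (b (rest m h))
    distinct : ∀ x y → x ∈ is ++ ws → y ∈ is ++ ws → x ~ y ≡ true → f′ x ≢ f′ y
    distinct x y m m′ e with x ∈? is | y ∈? is
    ... | yes i | yes i′ = λ _ → true≢false e (apart-in I i i′)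
    ... | yes _ | no h = λ eq → <⇒≢ (b (rest m′ h)) (≡-sym eq)
    ... | no h | yes _ = <⇒≢ (b (rest m h))
    ... | no h | no h′ = p (rest m h) (rest m′ h′) e

  identify : ∀ zs hs → known (keyed hs) (induced zs) ≡ true → ∃ λ zs′ → zs′ ↭ zs × induced zs′ ∈ hs
  identify zs hs e = ≅∈-permutation zs (lookFor-sound (key (induced zs)) (induced zs) hs e)

  remaining : ∀ k {m} (is ws : List V) {xs} → xs ↭ is ++ ws → length is ≡ k → length xs ≡ k + m → length ws ≡ m
  remaining _ is ws π refl e = +-cancelˡ-≡ (length is) _ _ (trans (≡-sym (trans (↭-length π) (length-++ is))) e)

  non-three-colourable : ∀ ws → Unique ws → length ws ≡ 10 → NotColourable 3 ws →
    ∃ λ bs → bs ↭ ws × (induced bs ∈ ten ⊎ induced bs ∈ sparseAt 10)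
  non-three-colourable ws U l N₃ with find-sparse J sparseCatalogue ws U
  ... | inj₂ (bs , σ , m) = bs , σ , inj₂ (subst (λ k → induced bs ∈ sparseAt k) l m)
  ... | inj₁ (is , k , I , sub) with complement is ws (independent-unique I) (All.lookup sub)
  ...   | us , π with remaining 4 is us π k l
  ...     | six with find-small us (Unique-++ʳ is (Unique-↭ π U)) (≤-reflexive six)
  ...       | us′ , σ , m =
    let ρ = ↭-trans π (++⁺ˡ is (↭-sym σ))
        (zs , τ , c) = Attach.completions-sound J 3 us′ is I (Unique-↭ ρ U) (NotColourable-↭ ρ N₃)
        (zs′ , τ′ , t) = identify zs ten (recognise completions-small
          (subst (λ k → induced us′ ∈ smallAt k) six m)
          (subst (λ k → induced zs ∈ completions 3 k (induced us′)) k c))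
    in zs′ , ↭-trans τ′ (↭-trans τ (↭-sym ρ)) , inj₁ t

  large-independent : ∀ is → Independent is → length is ≡ 5 → Found
  large-independent is I l with complement is vertices (independent-unique I) (λ _ → complete _)
  ... | ws , π with non-three-colourable ws (Unique-++ʳ is (Unique-↭ π unique)) (remaining 5 is ws π l fifteen)
                      (remove-independent I (NotColourable-↭ π N))
  ...   | bs , σ , m =
    let ρ = ↭-trans π (++⁺ˡ is (↭-sym σ))
        (zs , τ , c) = Attach.completions-sound J 4 bs is I (Unique-↭ ρ unique) (NotColourable-↭ ρ N)
        c′ = subst (λ k → induced zs ∈ completions 4 k (induced bs)) l c
        (zs′ , τ′ , t) = identify zs targets
          ([ (λ m → recognise completions-ten m c′) , (λ m → recognise completions-sparse m c′) ]′ m)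
    in zs′ , ↭-trans τ′ (↭-trans τ (↭-sym ρ)) , t

  degree : V → ℕ
  degree x = size (row x vertices)

  small-independent-at : (∀ is → Independent is → length is ≡ 5 → ⊥) →
    ∀ v ws → vertices ↭ v ∷ ws → (∀ u → degree v ≤ degree u) → Found
  small-independent-at α≤4 v ws ρ v-least =
    proj₁ found , ↭-trans (proj₁ (proj₂ found)) (↭-sym arrangement) , proj₂ (proj₂ found)
    where
    open Searching G J α≤4 using (searchAll-sound)
    us = keep (v ~_) ws
    rs = keep (not ∘ (v ~_)) ws
    π : vertices ↭ v ∷ us ++ rs
    π = ↭-trans ρ (prep v (keep-split ws))
    U : Unique (v ∷ us ++ rs)
    U = Unique-↭ π unique
    vu : All (λ u → v ~ u ≡ true) us
    vu = All.tabulate λ m → proj₂ (keep-∈ (v ~_) ws m)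
    vr : All (λ x → v ~ x ≡ false) rs
    vr = All.tabulate λ m → not-true (proj₂ (keep-∈ (not ∘ (v ~_)) ws m))
    v∉ : ∀ {x} → x ∈ us ++ rs → v ≢ x
    v∉ m with a ∷ _ ← U = All.lookup a m
    U′ : Unique (us ++ rs)
    U′ with _ ∷ u ← U = u
    Us : ∃ λ us′ → us′ ↭ us × induced us′ ∈ matchedAt (length us)
    Us with find-matched J v matchedCatalogue us (Unique-++ˡ us U′ , vu)
    ... | inj₂ x = x
    ... | inj₁ (is , l , I , _) = ⊥-elim (α≤4 is I l)
    Rs : ∃ λ rs′ → rs′ ↭ rs × induced rs′ ∈ sparseAt (length rs)
    Rs with find-sparse J sparseCatalogue rs (Unique-++ʳ us U′)
    ... | inj₂ x = x
    -- An independent 4-set among the non-neighbours becomes an independent 5-set together with `v`.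
    ... | inj₁ (is , l , I , m) = ⊥-elim (α≤4 (v ∷ is)
      (All.map (λ m → v∉ (∈-++⁺ʳ us m) , All.lookup vr m) m ∷ I) (cong suc l))
    us′ = proj₁ Us
    rs′ = proj₁ Rs
    arrangement : vertices ↭ v ∷ us′ ++ rs′
    arrangement = ↭-trans π (prep v (++⁺ (↭-sym (proj₁ (proj₂ Us))) (↭-sym (proj₁ (proj₂ Rs)))))
    vu′ : All (λ u → v ~ u ≡ true) us′
    vu′ = All.tabulate λ m → All.lookup vu (∈-resp-↭ (proj₁ (proj₂ Us)) m)
    vr′ : All (λ x → v ~ x ≡ false) rs′
    vr′ = All.tabulate λ m → All.lookup vr (∈-resp-↭ (proj₁ (proj₂ Rs)) m)
    -- Degrees do not depend on the order of the vertices, so they can be counted along `v`, its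
    -- neighbours and its non-neighbours; this turns minimality at `v` into the bound used by
    -- `initial`.
    degree-split : ∀ x → degree x ≡ size (x ~ v ∷ []) + (size (row x us′) + size (row x rs′))
    degree-split x = trans (size-↭ (x ~_) arrangement) (trans (size-++ (x ~ v ∷ []) _)
      (cong (size (x ~ v ∷ []) +_) (trans (cong size (map-++ (x ~_) us′ rs′)) (size-++ (row x us′) _))))
    degree-v : degree v ≡ length us′
    degree-v = trans (degree-split v) (trans (cong (λ b → size (b ∷ []) + (size (row v us′) + size (row v rs′))) (irrefl G v))
      (trans (cong₂ _+_ (size-all (v ~_) us′ vu′) (size-none (v ~_) rs′ vr′)) (+-identityʳ _)))
    bounded : All (λ u → length us′ ≤ suc (size (row u us′) + size (row u rs′))) us′
    bounded = All.tabulate λ {u} m → subst (_≤ suc (size (row u us′) + size (row u rs′))) degree-v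
      (≤-trans (v-least u) (≤-reflexive (trans (degree-split u)
        (cong (λ b → size (b ∷ []) + (size (row u us′) + size (row u rs′))) (~-sym (All.lookup vu′ m))))))
    fourteen : length us + length rs ≡ 14
    fourteen = suc-injective (trans (≡-sym (length-++ (v ∷ us))) (trans (≡-sym (↭-length π)) fifteen))
    rest : length rs ≡ 14 ∸ length us
    rest = trans (≡-sym (m+n∸m≡n (length us) (length rs))) (cong (_∸ length us) fourteen)
    found = searchAll-sound targets v us′ rs′ (matchedAt (length us)) (sparseAt (14 ∸ length us))
      (Unique-↭ arrangement unique) (NotColourable-↭ arrangement N) vu′ vr′ bounded
      (proj₂ (proj₂ Us)) (subst (λ k → induced rs′ ∈ sparseAt k) rest (proj₂ (proj₂ Rs)))
      (search-succeeds (length us) (proj₂ (proj₂ Us)))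

  small-independent : (∀ is → Independent is → length is ≡ 5 → ⊥) → Found
  small-independent α≤4 with minimum degree vertices fifteen
  ... | v , least with ∈-↭ (complete v)
  ...   | ws , ρ = small-independent-at α≤4 v ws ρ (λ u → All.lookup least (complete u))

  independent? : ∀ is → Dec (Independent is)
  independent? = AllPairs.allPairs? (λ x y → ¬? (x ≟ y) ×-dec (x ~ y ≟ᵇ false))

  classify : Found
  classify with anyList? 5 independent?
  ... | yes (is , l , I) = large-independent is I l
  ... | no none = small-independent λ is I l → none (is , l , I)

-- J₄-freeness and arrowing in terms of edges and colourings

Unique-lookup : ∀ {A : Set} {xs : List A} → Unique xs → ∀ {i j} → lookup xs i ≡ lookup xs j → i ≡ j
Unique-lookup (_ ∷ _) {Fin.zero} {Fin.zero} _ = refl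
Unique-lookup (x∉ ∷ _) {Fin.zero} {Fin.suc j} e = ⊥-elim (All.lookup x∉ (∈-lookup j) e)
Unique-lookup (x∉ ∷ _) {Fin.suc i} {Fin.zero} e = ⊥-elim (All.lookup x∉ (∈-lookup i) (≡-sym e))
Unique-lookup (_ ∷ u) {Fin.suc i} {Fin.suc j} e = cong Fin.suc (Unique-lookup u e)

-- The tips `x` and `y` come first because the missing edge of `J4` joins its vertices 0 and 1; the
-- hub `a`, `b` takes the places 2 and 3.
embed : ∀ {n} {E : Rel n} → (∀ {x y} → E x y → E y x) → ∀ a b x y → Unique (x ∷ y ∷ a ∷ b ∷ []) →
  E a b → E a x → E a y → E b x → E b y → Embeds J4 E
embed {E = E} s a b x y u ab ax ay bx by = lookup (x ∷ y ∷ a ∷ b ∷ []) , Unique-lookup u , edge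
  where
  edge : ∀ p q → Edge J4 p q → E (lookup (x ∷ y ∷ a ∷ b ∷ []) p) (lookup (x ∷ y ∷ a ∷ b ∷ []) q)
  edge 0F 2F _ = s ax
  edge 0F 3F _ = s bx
  edge 1F 2F _ = s ay
  edge 1F 3F _ = s by
  edge 2F 0F _ = ax
  edge 2F 1F _ = ay
  edge 2F 3F _ = ab
  edge 3F 0F _ = bx
  edge 3F 1F _ = by
  edge 3F 2F _ = s ab
  edge 3F 3F ()

module _ {n} (G : Graph n) where
  open InGraph G

  free⇒NoJ4 : Free J4 G → NoJ4 G
  free⇒NoJ4 free {a} {b} {x} {y} ab ax ay bx by with x ≟ y
  ... | yes x≡y = x≡y
  ... | no x≢y = ⊥-elim (free (embed ~-sym a b x y
    ((x≢y ∷ ~⇒≢ (~-sym ax) ∷ ~⇒≢ (~-sym bx) ∷ []) ∷ (~⇒≢ (~-sym ay) ∷ ~⇒≢ (~-sym by) ∷ []) ∷ (~⇒≢ ab ∷ []) ∷ [] ∷ [])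
    ab ax ay bx by))

  NoJ4⇒free : NoJ4 G → Free J4 G
  NoJ4⇒free J (f , inj , e) with inj (J (e 2F 3F refl) (e 2F 0F refl) (e 2F 1F refl) (e 3F 0F refl) (e 3F 1F refl))
  ... | ()

monochromatic : ∀ {n} {E : Rel n} {c : Fin n → Fin 4} → (∀ {x y} → E x y → E y x) → ∀ x y → x ≢ y → E x y → c x ≡ c y →
  ∃[ i ] CliqueIn E (λ v → c v ≡ i) 2
monochromatic {c = c} s x y x≢y e eq = c x , lookup (x ∷ y ∷ []) , Unique-lookup ((x≢y ∷ []) ∷ [] ∷ [])
  , (λ { 0F 0F h → ⊥-elim (h refl) ; 0F 1F _ → e ; 1F 0F _ → s e ; 1F 1F h → ⊥-elim (h refl) })
  , (λ { 0F → refl ; 1F → ≡-sym eq })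

module _ {n} (G : Graph n) where
  open InGraph G
  open Colouring G

  arrows⇒uncolourable : Arrows G two4 → NotColourable 4 (allFin n)
  arrows⇒uncolourable arrows f (bound , proper) with arrows (λ x → fromℕ< (bound (∈-allFin x)))
  ... | i , h , _ , e , p = proper (∈-allFin (h 0F)) (∈-allFin (h 1F)) (e 0F 1F λ ())
    (trans (≡-sym (toℕ-fromℕ< _)) (trans (cong toℕ (trans (p 0F) (≡-sym (p 1F)))) (toℕ-fromℕ< _)))

  uncolourable⇒arrows : NotColourable 4 (allFin n) → Arrows G two4
  uncolourable⇒arrows h c with any? (λ x → any? (λ y → (x ~ y ≟ᵇ true) ×-dec (c x ≟ c y)))
  ... | yes (x , y , e , eq) = monochromatic ~-sym x y (~⇒≢ e) e eq
  ... | no none = ⊥-elim (h (toℕ ∘ c) ((λ _ → toℕ<n _) , λ {x} {y} _ _ e eq → none (x , y , e , toℕ-injective eq)))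

-- A colouring of the target is pulled back along `φ`, and the clique found is pushed forward. This
-- serves subgraphs, isomorphisms and added vertices alike.
arrows-transport : ∀ {m n r} {E : Rel m} {E′ : Rel n} {a : Fin r → ℕ} (φ : Fin m → Fin n) →
  (∀ {x y} → φ x ≡ φ y → x ≡ y) → (∀ {x y} → E x y → E′ (φ x) (φ y)) → ArrowsRel E a → ArrowsRel E′ a
arrows-transport φ inj h arrows c with arrows (c ∘ φ)
... | i , f , f-inj , e , p = i , φ ∘ f , (λ eq → f-inj (inj eq)) , (λ p q n → h (e p q n)) , p

-- Graphs from triangular lists

at : Row → ℕ → Bool
at [] _ = false
at (b ∷ r) zero = b
at (b ∷ r) (suc i) = at r i

entry : Tri → ℕ → ℕ → Bool
entry [] i j = false
entry (r ∷ g) zero zero = false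
entry (r ∷ g) zero (suc j) = at r j
entry (r ∷ g) (suc i) zero = at r i
entry (r ∷ g) (suc i) (suc j) = entry g i j

entry-sym : ∀ g i j → entry g i j ≡ entry g j i
entry-sym [] i j = refl
entry-sym (r ∷ g) zero zero = refl
entry-sym (r ∷ g) zero (suc j) = refl
entry-sym (r ∷ g) (suc i) zero = refl
entry-sym (r ∷ g) (suc i) (suc j) = entry-sym g i j

entry-irrefl : ∀ g i → entry g i i ≡ false
entry-irrefl [] i = refl
entry-irrefl (r ∷ g) zero = refl
entry-irrefl (r ∷ g) (suc i) = entry-irrefl g i

fromTri : ∀ n → Tri → Graph n
fromTri n g = record
  { adj = λ i j → entry g (toℕ i) (toℕ j)
  ; sym = λ i j → entry-sym g (toℕ i) (toℕ j)
  ; irrefl = λ i → entry-irrefl g (toℕ i) }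

module _ {n} (G : Graph n) where
  open InGraph G

  at-row : ∀ w {ws y} (m : y ∈ ws) → at (row w ws) (toℕ (Any.index m)) ≡ w ~ y
  at-row w (here refl) = refl
  at-row w (there m) = at-row w m

  entry-induced : ∀ {ws x y} (m : x ∈ ws) (m′ : y ∈ ws) →
    entry (induced ws) (toℕ (Any.index m)) (toℕ (Any.index m′)) ≡ x ~ y
  entry-induced {x = x} (here refl) (here refl) = ≡-sym (irrefl G x)
  entry-induced {x = x} (here refl) (there m′) = at-row x m′
  entry-induced {y = y} (there m) (here refl) = trans (at-row y m) (~-sym refl)
  entry-induced (there m) (there m′) = entry-induced m m′

  -- Each vertex goes to its position in `zs`; as `zs` has no repetition, looking up a position is
  -- the inverse.
  induced-iso : ∀ zs → zs ↭ allFin n → Iso G (fromTri n (induced zs))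
  induced-iso zs π = mk↔ₛ′ to from to∘from from∘to , λ x y →
    ≡-sym (trans (cong₂ (entry (induced zs)) (toℕ-cast l _) (toℕ-cast l _)) (entry-induced (member x) (member y)))
    where
    l : length zs ≡ n
    l = trans (↭-length π) (length-tabulate (λ i → i))
    member : ∀ x → x ∈ zs
    member x = ∈-resp-↭ (↭-sym π) (∈-allFin x)
    to from : Fin n → Fin n
    to x = cast l (Any.index (member x))
    from p = lookup zs (cast (≡-sym l) p)
    from∘to : ∀ x → from (to x) ≡ x
    from∘to x = trans (cong (lookup zs) (trans (cast-trans l (≡-sym l) _) (cast-is-id refl _))) (≡-sym (lookup-index (member x)))
    to∘from : ∀ p → to (from p) ≡ p
    to∘from p = trans (cong (cast l) (Unique-lookup (Unique-↭ (↭-sym π) (allFin⁺ n)) (≡-sym (lookup-index (member (from p))))))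
      (trans (cast-trans (≡-sym l) l p) (cast-is-id refl p))

-- Isolated vertices and isomorphism invariants

addIsolated : ∀ {n} → Graph n → Graph (suc n)
addIsolated G = record { adj = a ; sym = s ; irrefl = i }
  where
  a : _
  a Fin.zero _ = false
  a (Fin.suc _) Fin.zero = false
  a (Fin.suc x) (Fin.suc y) = adj G x y
  s : ∀ x y → a x y ≡ a y x
  s Fin.zero Fin.zero = refl
  s Fin.zero (Fin.suc _) = refl
  s (Fin.suc _) Fin.zero = refl
  s (Fin.suc x) (Fin.suc y) = Graph.sym G x y
  i : ∀ x → a x x ≡ false
  i Fin.zero = refl
  i (Fin.suc x) = irrefl G x

addIsolated-NoJ4 : ∀ {n} (G : Graph n) → NoJ4 G → NoJ4 (addIsolated G)
addIsolated-NoJ4 G J {Fin.suc a} {Fin.suc b} {Fin.suc _} {Fin.suc _} ab ax ay bx by = cong Fin.suc (J {a} {b} ab ax ay bx by)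

addIsolated-family : ∀ {n} (G : Graph n) → InFamily two4 J4 n G → InFamily two4 J4 (suc n) (addIsolated G)
addIsolated-family G (free , arrows) =
  NoJ4⇒free (addIsolated G) (λ {a} {b} → addIsolated-NoJ4 G (free⇒NoJ4 G free) {a} {b}) , arrows-transport {E = Edge G} {E′ = Edge (addIsolated G)} Fin.suc suc-inj (λ e → e) arrows
  where
  suc-inj : ∀ {n} {x y : Fin n} → Fin.suc x ≡ Fin.suc y → x ≡ y
  suc-inj refl = refl

iso-sym : ∀ {n} {G H : Graph n} → Iso G H → Iso H G
iso-sym {G = G} {H} (φ , e) = ↔-sym φ , λ x y → ≡-sym (trans (e _ _)
  (cong₂ (adj H) (Inverse.strictlyInverseˡ φ x) (Inverse.strictlyInverseˡ φ y)))

iso-injective : ∀ {n} (φ : Fin n ↔ Fin n) {x y} → Inverse.to φ x ≡ Inverse.to φ y → x ≡ y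
iso-injective φ {x} {y} e = trans (≡-sym (Inverse.strictlyInverseʳ φ x))
  (trans (cong (Inverse.from φ) e) (Inverse.strictlyInverseʳ φ y))

degreeSum : ∀ {n} → Graph n → ℕ
degreeSum {n} G = sum (map (λ x → size (map (adj G x) (allFin n))) (allFin n))

iso-degreeSum : ∀ {n} {G H : Graph n} → Iso G H → degreeSum G ≡ degreeSum H
iso-degreeSum {n} {G} {H} (φ , e) = trans (cong sum (map-cong degree (allFin n)))
  (trans (cong sum (map-∘ (allFin n))) (sum-↭ (map⁺ _ images)))
  where
  to = Inverse.to φ
  images : map to (allFin n) ↭ allFin n
  -- The images are distinct and as many as the vertices, so nothing is left over outside them.
  images with complement (map to (allFin n)) (allFin n) (Unique-map⁺ (iso-injective φ) (allFin⁺ n)) (λ _ → ∈-allFin _)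
  ... | [] , π = ↭-sym (subst (allFin n ↭_) (++-identityʳ _) π)
  ... | y ∷ ys , π = ⊥-elim (m≢1+m+n (length (allFin n)) (trans (↭-length π)
      (trans (length-++ (map to (allFin n))) (trans (cong (_+ suc (length ys)) (length-map to (allFin n))) (+-suc _ _)))))
  degree : ∀ x → size (map (adj G x) (allFin n)) ≡ size (map (adj H (to x)) (allFin n))
  degree x = trans (cong size (trans (map-cong (e x) (allFin n)) (map-∘ (allFin n)))) (size-↭ (adj H (to x)) images)

-- Computable criteria for arrowing, J₄-freeness, minimality and maximality

recolour-∈ : ∀ r {css cs c} → cs ∈ css → c ∈ fourColours → clash c r cs ≡ false → c ∷ cs ∈ recolour r css
recolour-∈ r {css} = go css
  where
  hit : ∀ p {c cs rest} → c ∈ p → clash c r cs ≡ false → c ∷ cs ∈ extend p r cs rest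
  hit (c ∷ p) (here refl) e rewrite e = here refl
  hit (d ∷ p) {cs = cs} (there m) e with clash d r cs
  ... | true = hit p m e
  ... | false = there (hit p m e)
  skip : ∀ p {cs ds rest} → ds ∈ rest → ds ∈ extend p r cs rest
  skip [] m = m
  skip (d ∷ p) {cs} m with clash d r cs
  ... | true = skip p m
  ... | false = there (skip p m)
  go : ∀ css {cs c} → cs ∈ css → c ∈ fourColours → clash c r cs ≡ false → c ∷ cs ∈ recolour r css
  go (cs ∷ css) (here refl) p e = hit fourColours p e
  go (cs ∷ css) (there m) p e = skip fourColours (go css m p e)

fourColours-complete : ∀ {c} → c < 4 → c ∈ fourColours
fourColours-complete {0} _ = here refl
fourColours-complete {1} _ = there (here refl)
fourColours-complete {2} _ = there (there (here refl))
fourColours-complete {3} _ = there (there (there (here refl)))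
fourColours-complete {suc (suc (suc (suc c)))} (s≤s (s≤s (s≤s (s≤s ()))))

≡ᵇ-true : ∀ m n → (m ≡ᵇ n) ≡ true → m ≡ n
≡ᵇ-true zero zero _ = refl
≡ᵇ-true (suc m) (suc n) e = cong suc (≡ᵇ-true m n e)

implies : Bool → Bool → Bool
implies a b = not a ∨ b

modus-ponens : ∀ {a b} → implies a b ≡ true → a ≡ true → b ≡ true
modus-ponens e refl = e

-- Looks for a neighbour with which the vertex of row `r` forms the hub of a `J₄`, that is, one with
-- two common neighbours.
hubIn : Row → Row → List Row → Bool
hubIn r (b ∷ s) (t ∷ ts) = (b ∧ meetsTwice r t) ∨ hubIn r s ts
hubIn r _ _ = false

module _ {n} (G : Graph n) where
  open InGraph G
  open Colouring G

  clash-proper : ∀ f w ws → (∀ {y} → y ∈ ws → w ~ y ≡ true → f w ≢ f y) → clash (f w) (row w ws) (map f ws) ≡ false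
  clash-proper f w [] h = refl
  clash-proper f w (y ∷ ws) h with w ~ y in e
  ... | false = clash-proper f w ws (λ m → h (there m))
  ... | true with f w ≡ᵇ f y in e′
  ...   | true = ⊥-elim (h (here refl) e (≡ᵇ-true _ _ e′))
  ...   | false = clash-proper f w ws (λ m → h (there m))

  -- All four colours are tried at every vertex, so every proper colouring is listed literally and
  -- an empty list proves arrowing.
  recolourBy-complete : ∀ f ws → Proper 4 ws f → map f ws ∈ recolourBy (induced ws) ([] ∷ [])
  recolourBy-complete f [] _ = here refl
  recolourBy-complete f (w ∷ ws) (b , p) = recolour-∈ (row w ws)
    (recolourBy-complete f ws ((λ m → b (there m)) , λ m m′ → p (there m) (there m′)))
    (fourColours-complete (b (here refl)))
    (clash-proper f w ws (λ m → p (here refl) (there m)))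

  exhausted⇒arrows : null (recolourBy (induced (allFin n)) ([] ∷ [])) ≡ true → Arrows G two4
  exhausted⇒arrows e = uncolourable⇒arrows G λ f p → true≢false e (null-∈ (recolourBy-complete f (allFin n) p))

  coloured⇒¬arrows : null (colourings 4 (induced (allFin n))) ≡ false → ¬ Arrows G two4
  coloured⇒¬arrows e arrows = let (cs , m) = nonempty _ e in
    arrows⇒uncolourable G arrows _ (coloured-proper (colourings-sound 4 (allFin n) m))

module _ {n} (G : Graph n) where
  open InGraph G
  open Colouring G

  hubIn-complete : ∀ a {b x y} → a ~ b ≡ true → x ≢ y → a ~ x ≡ true → a ~ y ≡ true → b ~ x ≡ true → b ~ y ≡ true →
    ∀ ws → b ∈ ws → hubIn (row a (allFin n)) (row a ws) (map (λ w → row w (allFin n)) ws) ≡ true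
  hubIn-complete a {b} ab x≢y ax ay bx by (_ ∷ ws) (here refl)
    rewrite ab | meetsTwice-complete (a ~_) (b ~_) (∈-allFin _) (∈-allFin _) x≢y ax bx ay by = refl
  hubIn-complete a ab x≢y ax ay bx by (w ∷ ws) (there m) with (a ~ w) ∧ meetsTwice (row a (allFin n)) (row w (allFin n))
  ... | true = refl
  ... | false = hubIn-complete a ab x≢y ax ay bx by ws m

  J4-free : List Row → Bool
  J4-free rs = all (λ r → not (hubIn r r rs)) rs

  J4-free-sound : J4-free (map (λ w → row w (allFin n)) (allFin n)) ≡ true → NoJ4 G
  J4-free-sound e {a} {b} {x} {y} ab ax ay bx by with x ≟ y
  ... | yes x≡y = x≡y
  ... | no x≢y = ⊥-elim (true≢false (hubIn-complete a ab x≢y ax ay bx by (allFin n) (∈-allFin b))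
    (not-true (all-∈ e (∈-map⁺ (λ w → row w (allFin n)) (∈-allFin a)))))

  ends : V → V → V → V → Bool
  ends i j x y = (does (x ≟ i) ∧ does (y ≟ j)) ∨ (does (x ≟ j) ∧ does (y ≟ i))

  Ends : V → V → V → V → Set
  Ends i j x y = (x ≡ i × y ≡ j) ⊎ (x ≡ j × y ≡ i)

  does-true : ∀ {x y : V} → does (x ≟ y) ≡ true → x ≡ y
  does-true {x} {y} e with yes p ← x ≟ y = p

  does-refl : ∀ (x : V) → does (x ≟ x) ≡ true
  does-refl x with x ≟ x
  ... | yes _ = refl
  ... | no h = ⊥-elim (h refl)

  ends-sound : ∀ {i j x y} → ends i j x y ≡ true → Ends i j x y
  ends-sound {i} {j} {x} {y} e with ∨-true {does (x ≟ i) ∧ does (y ≟ j)} e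
  ... | inj₁ e′ = let (p , q) = ∧-true {does (x ≟ i)} e′ in inj₁ (does-true p , does-true q)
  ... | inj₂ e′ = let (p , q) = ∧-true {does (x ≟ j)} e′ in inj₂ (does-true p , does-true q)

  ends-complete : ∀ {i j x y} → Ends i j x y → ends i j x y ≡ true
  ends-complete {i} {j} (inj₁ (refl , refl)) rewrite does-refl i | does-refl j = refl
  ends-complete {i} {j} (inj₂ (refl , refl)) rewrite does-refl i | does-refl j = ∨-zeroʳ _

  -- The relation `removeEdge` as a graph with Boolean adjacency, so that its colourings can be
  -- computed.
  minus : V → V → Graph n
  minus i j = record
    { adj = λ x y → x ~ y ∧ not (ends i j x y)
    ; sym = λ x y → cong₂ (λ a b → a ∧ not b) (Graph.sym G x y)
        (trans (∨-comm (does (x ≟ i) ∧ does (y ≟ j)) _)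
          (cong₂ _∨_ (∧-comm (does (x ≟ j)) _) (∧-comm (does (x ≟ i)) _)))
    ; irrefl = λ x → cong (_∧ not (ends i j x x)) (irrefl G x) }

  minus⇒remove : ∀ {i j x y} → Edge (minus i j) x y → removeEdge G i j x y
  minus⇒remove {x = x} {y} e = let (p , q) = ∧-true {x ~ y} e in
    p , λ h → true≢false (ends-complete h) (not-true q)

  remove⇒minus : ∀ {i j x y} → removeEdge G i j x y → Edge (minus i j) x y
  remove⇒minus (p , h) = cong₂ _∧_ p (cong not (refute (λ e → h (ends-sound e))))

  minus-colourable : V → V → Bool
  minus-colourable i j = not (null (colourings 4 (InGraph.induced (minus i j) (allFin n))))

  -- Each edge is tested in one orientation; `swap-ends` supplies the other.
  critical : Bool
  critical = all (λ i → all (λ j → implies (toℕ i ≤ᵇ toℕ j) (implies (i ~ j) (minus-colourable i j))) (allFin n)) (allFin n)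

  swap-ends : ∀ {i j x y} → removeEdge G i j x y → removeEdge G j i x y
  swap-ends (e , h) = e , λ { (inj₁ x) → h (inj₂ x) ; (inj₂ x) → h (inj₁ x) }

  critical-sound : Arrows G two4 → critical ≡ true → MinimalArrows G two4
  critical-sound arrows e = arrows , removal
    where
    ordered : ∀ i j → toℕ i ≤ toℕ j → Edge G i j → ¬ ArrowsRel (removeEdge G i j) two4
    ordered i j h ij arrows = true≢false (modus-ponens (modus-ponens
        (all-∈ (all-∈ e (∈-allFin i)) (∈-allFin j)) (Equivalence.to T-≡ (≤⇒≤ᵇ h))) ij)
      (refute λ c → coloured⇒¬arrows (minus i j) (not-true c)
        (arrows-transport {E = removeEdge G i j} {E′ = Edge (minus i j)} (λ x → x) (λ x → x) remove⇒minus arrows))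
    removal : ∀ i j → Edge G i j → ¬ ArrowsRel (removeEdge G i j) two4
    removal i j ij arrows with ≤-total (toℕ i) (toℕ j)
    ... | inj₁ h = ordered i j h ij arrows
    ... | inj₂ h = ordered j i h (~-sym ij)
      (arrows-transport {E = removeEdge G i j} {E′ = removeEdge G j i} (λ x → x) (λ x → x) swap-ends arrows)

  -- A J₄ on the new edge ij has it either as its hub or as one of the four outer edges
  closes : V → V → Bool
  closes i j = meetsTwice (row i (allFin n)) (row j (allFin n)) ∨
    any (λ x → (i ~ x ∧ j ~ x) ∧ (meets (row x (allFin n)) (row i (allFin n)) ∨ meets (row x (allFin n)) (row j (allFin n)))) (allFin n)

  saturated : Bool
  saturated = all (λ i → all (λ j → implies (not (does (i ≟ j))) (i ~ j ∨ closes i j)) (allFin n)) (allFin n)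

  addEdge-sym : ∀ {i j x y} → addEdge G i j x y → addEdge G i j y x
  addEdge-sym (inj₁ e) = inj₁ (~-sym e)
  addEdge-sym (inj₂ (inj₁ (p , q))) = inj₂ (inj₂ (q , p))
  addEdge-sym (inj₂ (inj₂ (p , q))) = inj₂ (inj₁ (q , p))

  closes-sound : ∀ i j → i ≢ j → i ~ j ≡ false → closes i j ≡ true → Embeds J4 (addEdge G i j)
  closes-sound i j i≢j ij e with ∨-true {meetsTwice (row i (allFin n)) (row j (allFin n))} e
  ... | inj₁ e′ = let (x , y , _ , _ , x≢y , ix , jx , iy , jy) = meetsTwice-sound (i ~_) (j ~_) (allFin n) (allFin⁺ n) e′ in
    embed addEdge-sym i j x y
      ((x≢y ∷ ~⇒≢ (~-sym ix) ∷ ~⇒≢ (~-sym jx) ∷ []) ∷ (~⇒≢ (~-sym iy) ∷ ~⇒≢ (~-sym jy) ∷ []) ∷ (i≢j ∷ []) ∷ [] ∷ [])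
      (inj₂ (inj₁ (refl , refl))) (inj₁ ix) (inj₁ iy) (inj₁ jx) (inj₁ jy)
  ... | inj₂ e′ with any-∈ _ (allFin n) e′
  ...   | x , _ , q with ∧-true {i ~ x ∧ j ~ x} q
  ...     | r , s with ∧-true {i ~ x} r | ∨-true {meets (row x (allFin n)) (row i (allFin n))} s
  ...       | ix , jx | inj₁ t = let (z , _ , xz , iz) = meets-sound (x ~_) (i ~_) (allFin n) t in
    -- The hub joins `i` and `x`, the tips are `j` and `z`, and the new edge is the outer edge from
    -- `i` to `j`. The tips differ because `z` is an old neighbour of `i` and `j` is not.
    embed addEdge-sym i x j z (distinct i≢j ij ix jx xz iz)
      (inj₁ ix) (inj₂ (inj₁ (refl , refl))) (inj₁ iz) (inj₁ (~-sym jx)) (inj₁ xz)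
    where
    distinct : ∀ {i j x z} → i ≢ j → i ~ j ≡ false → i ~ x ≡ true → j ~ x ≡ true → x ~ z ≡ true → i ~ z ≡ true →
      Unique (j ∷ z ∷ i ∷ x ∷ [])
    distinct n ij ix jx xz iz = ((λ { refl → true≢false iz ij }) ∷ (λ h → n (≡-sym h)) ∷ ~⇒≢ jx ∷ [])
      ∷ (~⇒≢ (~-sym iz) ∷ ~⇒≢ (~-sym xz) ∷ []) ∷ (~⇒≢ ix ∷ []) ∷ [] ∷ []
  ...       | ix , jx | inj₂ t = let (z , _ , xz , jz) = meets-sound (x ~_) (j ~_) (allFin n) t in
    embed addEdge-sym j x i z
      (((λ { refl → true≢false jz (~-sym ij) }) ∷ i≢j ∷ ~⇒≢ ix ∷ [])
       ∷ (~⇒≢ (~-sym jz) ∷ ~⇒≢ (~-sym xz) ∷ []) ∷ (~⇒≢ jx ∷ []) ∷ [] ∷ [])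
      (inj₁ jx) (inj₂ (inj₂ (refl , refl))) (inj₁ jz) (inj₁ (~-sym ix)) (inj₁ xz)

  saturated-sound : Free J4 G → saturated ≡ true → MaximalFree J4 G
  saturated-sound free e = free , λ i j i≢j ¬ij → closes-sound i j i≢j (refute ¬ij)
    (conclude i j i≢j ¬ij (all-∈ (all-∈ e (∈-allFin i)) (∈-allFin j)))
    where
    conclude : ∀ i j → i ≢ j → ¬ Edge G i j → implies (not (does (i ≟ j))) (i ~ j ∨ closes i j) ≡ true → closes i j ≡ true
    conclude i j i≢j ¬ij e with ∨-true {i ~ j} (modus-ponens e (cong not (refute (λ d → i≢j (does-true d)))))
    ... | inj₁ ij = ⊥-elim (¬ij ij)
    ... | inj₂ c = c

  hasNeighbours : Bool
  hasNeighbours = all (λ i → any (i ~_) (allFin n)) (allFin n)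

  hasNeighbours-sound : hasNeighbours ≡ true → ∀ i → ∃ λ y → i ~ y ≡ true
  hasNeighbours-sound e i = let (y , _ , iy) = any-∈ (i ~_) (allFin n) (all-∈ e (∈-allFin i)) in y , iy

-- An isomorphism would carry the added vertex to an isolated vertex of `H`.
addIsolated-iso : ∀ {n} {G : Graph n} {H : Graph (suc n)} → hasNeighbours H ≡ true → ¬ Iso (addIsolated G) H
addIsolated-iso {G = G} {H} h (φ , e) =
  let (y , n) = hasNeighbours-sound H h (Inverse.to φ Fin.zero)
  in true≢false n (trans (cong (adj H (Inverse.to φ Fin.zero)) (≡-sym (Inverse.strictlyInverseˡ φ y)))
       (≡-sym (e Fin.zero (Inverse.from φ y))))

included : ∀ {n} → (Fin n → Fin n → Bool) → (Fin n → Fin n → Bool) → Bool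
included {n} A B = all (λ x → all (λ y → implies (A x y) (B x y)) (allFin n)) (allFin n)

included-sound : ∀ {n} {A B : Fin n → Fin n → Bool} → included A B ≡ true → ∀ {x y} → A x y ≡ true → B x y ≡ true
included-sound e {x} {y} = modus-ponens (all-∈ (all-∈ e (∈-allFin x)) (∈-allFin y))

-- The five graphs

folkman : Fin 5 → Graph 15
folkman k = fromTri 15 (lookup targets k)

neighbourRows : Graph 15 → List Row
neighbourRows G = map (λ x → map (adj G x) (allFin 15)) (allFin 15)

folkman-free : ∀ k → Free J4 (folkman k)
folkman-free k = NoJ4⇒free (folkman k) (λ {a} {b} → J4-free-sound (folkman k) (check k) {a} {b})
  where
  check : ∀ k → J4-free (folkman k) (neighbourRows (folkman k)) ≡ true
  check 0F = refl
  check 1F = refl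
  check 2F = refl
  check 3F = refl
  check 4F = refl

arrows-mono : ∀ {G H : Graph 15} → included (adj G) (adj H) ≡ true → Arrows G two4 → Arrows H two4
arrows-mono {G} {H} e = arrows-transport {E = Edge G} {E′ = Edge H} (λ x → x) (λ x → x) (included-sound {A = adj G} {B = adj H} e)

-- Only the two sparsest graphs of the deletion order are checked by exhausting colourings; each of
-- the others contains one of them.
folkman-arrows : ∀ k → Arrows (folkman k) two4
folkman-arrows 3F = exhausted⇒arrows (folkman 3F) refl
folkman-arrows 4F = exhausted⇒arrows (folkman 4F) refl
folkman-arrows 2F = arrows-mono {folkman 4F} {folkman 2F} refl (folkman-arrows 4F)
folkman-arrows 1F = arrows-mono {folkman 3F} {folkman 1F} refl (folkman-arrows 3F)
folkman-arrows 0F = arrows-mono {folkman 3F} {folkman 0F} refl (folkman-arrows 3F)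

folkman-family : ∀ k → InFamily two4 J4 15 (folkman k)
folkman-family k = folkman-free k , folkman-arrows k

folkman-neighbours : ∀ k → hasNeighbours (folkman k) ≡ true
folkman-neighbours 0F = refl
folkman-neighbours 1F = refl
folkman-neighbours 2F = refl
folkman-neighbours 3F = refl
folkman-neighbours 4F = refl

found⇒iso : ∀ G → (∃ λ zs → zs ↭ allFin 15 × InGraph.induced G zs ∈ targets) → ∃[ k ] Iso G (folkman k)
found⇒iso G (zs , π , m) = Any.index m , subst (λ g → Iso G (fromTri 15 g)) (lookup-index m) (induced-iso G zs π)

classification : ∀ G → InFamily two4 J4 15 G → ∃[ k ] Iso G (folkman k)
classification G (free , arrows) = found⇒iso G (Classification.classify G (free⇒NoJ4 G free)
  (allFin 15) (allFin⁺ 15) ∈-allFin refl (arrows⇒uncolourable G arrows))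

no-isolated : ∀ (G : Graph 14) → ¬ InFamily two4 J4 14 G
no-isolated G fam = excluded (classification (addIsolated G) (addIsolated-family G fam))
  where
  excluded : ¬ (∃[ k ] Iso (addIsolated G) (folkman k))
  excluded (k , iso) = addIsolated-iso {G = G} {folkman k} (folkman-neighbours k) iso

-- Isolated vertices are added until there are 14 vertices; one more would give a member on 15
-- vertices with an isolated vertex, unlike all five graphs.
no-smaller : ∀ j n → j + n ≡ 14 → (G : Graph n) → ¬ InFamily two4 J4 n G
no-smaller zero n refl G fam = no-isolated G fam
no-smaller (suc j) n e G fam = no-smaller j (suc n) (trans (+-suc j n) e) (addIsolated G) (addIsolated-family G fam)

folkman-maximal : MaximalFree J4 (folkman 0F)
folkman-maximal = saturated-sound (folkman 0F) (folkman-free 0F) refl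

-- `G` with the edge from `i` to `j` still lies inside the J₄-free graph `H`, so this edge creates
-- no `J₄`.
¬maximal : ∀ {G H : Graph 15} i j → Free J4 H → i ≢ j → adj G i j ≡ false → included (adj G) (adj H) ≡ true →
  adj H i j ≡ true → ¬ MaximalFree J4 G
¬maximal {G} {H} i j free i≢j ij e hij (_ , max) with max i j i≢j (λ t → true≢false t ij)
... | f , inj , edge = free (f , inj , λ p q pq → bound (edge p q pq))
  where
  bound : ∀ {x y} → addEdge G i j x y → Edge H x y
  bound (inj₁ t) = included-sound {A = adj G} {B = adj H} e t
  bound (inj₂ (inj₁ (refl , refl))) = hij
  bound (inj₂ (inj₂ (refl , refl))) = InGraph.~-sym H hij

only-maximal : ∀ l → MaximalFree J4 (folkman l) → l ≡ 0F
only-maximal 0F _ = refl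
-- In each case the edge added back is the one whose deletion led from the larger graph to the
-- smaller.
only-maximal 1F m = ⊥-elim (¬maximal {folkman 1F} {folkman 0F} 0F 5F (folkman-free 0F) (λ ()) refl refl refl m)
only-maximal 2F m = ⊥-elim (¬maximal {folkman 2F} {folkman 1F} 1F 3F (folkman-free 1F) (λ ()) refl refl refl m)
only-maximal 3F m = ⊥-elim (¬maximal {folkman 3F} {folkman 1F} (Fin.#_ 12) (Fin.#_ 13) (folkman-free 1F) (λ ()) refl refl refl m)
only-maximal 4F m = ⊥-elim (¬maximal {folkman 4F} {folkman 2F} 2F 4F (folkman-free 2F) (λ ()) refl refl refl m)

folkman-minimal₃ : MinimalArrows (folkman 3F) two4
folkman-minimal₃ = critical-sound (folkman 3F) (folkman-arrows 3F) refl

folkman-minimal₄ : MinimalArrows (folkman 4F) two4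
folkman-minimal₄ = critical-sound (folkman 4F) (folkman-arrows 4F) refl

Removable : Graph 15 → Set
Removable G = ∃₂ λ i j → Edge G i j × ArrowsRel (removeEdge G i j) two4

removable : ∀ {G H : Graph 15} i j → Edge G i j → Arrows H two4 → included (adj H) (adj (minus G i j)) ≡ true → Removable G
removable {G} {H} i j ij arrows e = i , j , ij , arrows-transport {E = Edge H} {E′ = removeEdge G i j} (λ x → x) (λ x → x)
  (λ h → minus⇒remove G (included-sound {A = adj H} {B = adj (minus G i j)} e h)) arrows

-- The same deletions, read downwards, leave a graph that still arrows.
removable₀ : Removable (folkman 0F)
removable₀ = removable {folkman 0F} {folkman 1F} 0F 5F refl (folkman-arrows 1F) refl

removable₁ : Removable (folkman 1F)
removable₁ = removable {folkman 1F} {folkman 2F} 1F 3F refl (folkman-arrows 2F) refl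

removable₂ : Removable (folkman 2F)
removable₂ = removable {folkman 2F} {folkman 4F} 2F 4F refl (folkman-arrows 4F) refl

¬minimal : ∀ {G} → Removable G → ¬ MinimalArrows G two4
¬minimal (i , j , ij , arrows) (_ , min) = min i j ij arrows

only-minimal : ∀ m → MinimalArrows (folkman m) two4 → m ≡ 3F ⊎ m ≡ 4F
only-minimal 0F h = ⊥-elim (¬minimal {folkman 0F} removable₀ h)
only-minimal 1F h = ⊥-elim (¬minimal {folkman 1F} removable₁ h)
only-minimal 2F h = ⊥-elim (¬minimal {folkman 2F} removable₂ h)
only-minimal 3F _ = inj₁ refl
only-minimal 4F _ = inj₂ refl

iso-removable : ∀ {G H : Graph 15} → Iso G H → Removable G → Removable H
iso-removable {G} {H} (φ , e) (i , j , ij , arrows) = to i , to j , trans (≡-sym (e i j)) ij ,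
  arrows-transport {E = removeEdge G i j} {E′ = removeEdge H (to i) (to j)} to (iso-injective φ)
    (λ {x} {y} (xy , h) → trans (≡-sym (e x y)) xy , λ
      { (inj₁ (p , q)) → h (inj₁ (iso-injective φ p , iso-injective φ q))
      ; (inj₂ (p , q)) → h (inj₂ (iso-injective φ p , iso-injective φ q)) }) arrows
  where to = Inverse.to φ

-- Twice the edge numbers 45, 44, 43, 43 and 42; the only tie is between `2F` and `3F`.
degreeSums : Fin 5 → ℕ
degreeSums 0F = 90
degreeSums 1F = 88
degreeSums 2F = 86
degreeSums 3F = 86
degreeSums 4F = 84

folkman-degreeSum : ∀ k → degreeSum (folkman k) ≡ degreeSums k
folkman-degreeSum 0F = refl
folkman-degreeSum 1F = refl
folkman-degreeSum 2F = refl
folkman-degreeSum 3F = refl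
folkman-degreeSum 4F = refl

degreeSums-distinct : ∀ k l → degreeSums k ≡ degreeSums l → k ≡ l ⊎ ((k ≡ 2F × l ≡ 3F) ⊎ (k ≡ 3F × l ≡ 2F))
degreeSums-distinct = from-yes (all? λ k → all? λ l → (degreeSums k ℕ.≟ degreeSums l) →-dec
  ((k ≟ l) ⊎-dec (((k ≟ 2F) ×-dec (l ≟ 3F)) ⊎-dec ((k ≟ 3F) ×-dec (l ≟ 2F)))))

-- Equal edge numbers, but only the first has an edge whose removal preserves arrowing, a property
-- invariant under isomorphism.
two≇three : ¬ Iso (folkman 2F) (folkman 3F)
two≇three φ = ¬minimal {folkman 3F} (iso-removable {folkman 2F} {folkman 3F} φ removable₂) folkman-minimal₃

folkman-distinct : ∀ k l → Iso (folkman k) (folkman l) → k ≡ l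
folkman-distinct k l φ = separate k l φ (degreeSums-distinct k l
    (trans (≡-sym (folkman-degreeSum k)) (trans (iso-degreeSum {G = folkman k} {folkman l} φ) (folkman-degreeSum l))))
  where
  separate : ∀ k l → Iso (folkman k) (folkman l) →
    k ≡ l ⊎ ((k ≡ 2F × l ≡ 3F) ⊎ (k ≡ 3F × l ≡ 2F)) → k ≡ l
  separate k l φ (inj₁ e) = e
  separate k l φ (inj₂ (inj₁ (refl , refl))) = ⊥-elim (two≇three φ)
  separate k l φ (inj₂ (inj₂ (refl , refl))) = ⊥-elim (two≇three (iso-sym {G = folkman 3F} {folkman 2F} φ))

theorem4 : FolkmanNumberIs two4 J4 15
    × Σ (Fin 5 → Graph 15) λ R →
    (∀ k → InFamily two4 J4 15 (R k))
    × (∀ k l → Iso (R k) (R l) → k ≡ l)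
    × (∀ G → InFamily two4 J4 15 G → ∃[ k ] Iso G (R k))
    × (∃[ k ] (MaximalFree J4 (R k) × (∀ l → MaximalFree J4 (R l) → l ≡ k)))
    × (∃[ k ] ∃[ l ] (k ≢ l × MinimalArrows (R k) two4 × MinimalArrows (R l) two4
    × (∀ m → MinimalArrows (R m) two4 → m ≡ k ⊎ m ≡ l)))
theorem4 = ((folkman 0F , folkman-family 0F) , smaller)
  , folkman , folkman-family , folkman-distinct , classification
  , (0F , folkman-maximal , only-maximal)
  , (3F , 4F , (λ ()) , folkman-minimal₃ , folkman-minimal₄ , only-minimal)
  where
  smaller : ∀ n → n < 15 → (G : Graph n) → ¬ InFamily two4 J4 n G
  smaller n (s≤s h) = no-smaller (14 ∸ n) n (m∸n+n≡m h)
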